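{- For all $\alpha\in[0,2/9]$, it holds that \[\varphi_2(\alpha)\ge\frac{3}{4}\alpha\left(3-\sqrt{8\alpha+1}\right).\]
   Context: Let $d$ be a positive integer and $V$ a finite set. A $d$-system $E$ on $V$ is a family of $d$-element subsets of $V$. Its density is $\|E\|:=|E|/\binom{|V|}{d}$. The coboundary $\delta E$ of a $d$-system $E$ on $V$ is the $(d+1)$-system on $V$ consisting of those $(d+1)$-element subsets of $V$ that contain an odd number of sets of $E$. A $d$-system $E$ on $V$ is minimal if $\|E\|\le\|E'\|$ for every $d$-system $E'$ on $V$ with $\delta E=\delta E'$ (equivalently, $\|E\|\le\|E\,\triangle\,\delta D\|$ for every $(d-1)$-system $D$ on $V$, where $\triangle$ is the symmetric difference). Let $\mathcal{M}_d(V)$ be the set of all minimal $d$-systems on $V$. For $\alpha\in[0,1/2]$ define \[\varphi_d(\alpha):=\liminf_{|V|\to\infty}\min\{\|\delta E\| : E\in\mathcal{M}_d(V)\text{ and }\|E\|\ge\alpha\}.\] The claim concerns the case $d=2$. -}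

module Defs where

open import Data.Bool.Base using (Bool; T)
open import Data.Fin.Subset.Properties using (_⊆?_)
open import Data.Integer.Base as ℤ using (+_)
import Data.Integer.Properties as ℤₚ
open import Data.List.Base using (List; []; _∷_; _++_; map; filter; length)
open import Data.Nat.Base as ℕ using (ℕ; zero; suc; parity)
open import Data.Nat.Combinatorics using (_C_)
import Data.Nat.Properties as ℕₚ
open import Data.Parity.Base using (1ℙ)
import Data.Parity.Properties as ℙₚ
open import Data.Product.Base using (∃-syntax; _×_; _,_; proj₁; proj₂)
open import Data.Rational as ℚ using (ℚ; 0ℚ; 1ℚ; _/_)
import Data.Rational.Properties as ℚₚ
open import Data.Rational.Solver using (module +-*-Solver)
import Data.Rational.Unnormalised.Base as ℚᵘ
import Data.Rational.Unnormalised.Properties as ℚᵘₚ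
open import Data.Sum.Base using (_⊎_; inj₁; inj₂; [_,_]′)
import Data.Vec.Base as Vec
open import Relation.Binary.PropositionalEquality
open import Relation.Nullary using (Dec; ¬_; yes; no; contradiction)
open import Relation.Nullary.Decidable using (⌊_⌋; toWitness; T?; _×-dec_)

module RationalLemmas where
  open import Data.Rational.Base hiding (truncate)
  open import Data.Rational.Properties

  ∣p-q∣≤r : ∀ p q {r} → p ≤ q + r → q ≤ p + r → ∣ p - q ∣ ≤ r
  ∣p-q∣≤r p q {r} a b with ∣p∣≡p∨∣p∣≡-p (p - q)
  ... | inj₁ e = subst₂ _≤_ (sym e) (solve 2 (λ q r → q :+ r :- q := r) refl q r) (+-monoˡ-≤ (- q) a)
    where open +-*-Solver
  ... | inj₂ e = subst₂ _≤_ (trans (solve 2 (λ p q → q :- p := :- (p :- q)) refl p q) (sym e))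
                   (solve 2 (λ p r → p :+ r :- p := r) refl p r) (+-monoˡ-≤ (- p) b)
    where open +-*-Solver

  p≤∣p∣ : ∀ p → p ≤ ∣ p ∣
  p≤∣p∣ p with ≤-total 0ℚ p
  ... | inj₁ 0≤p = ≤-reflexive (sym (0≤p⇒∣p∣≡p 0≤p))
  ... | inj₂ p≤0 = ≤-trans p≤0 (0≤∣p∣ p)

  ∣p-q∣≤r⇒p≤q+r : ∀ p q {r} → ∣ p - q ∣ ≤ r → p ≤ q + r
  ∣p-q∣≤r⇒p≤q+r p q {r} h = subst (_≤ q + r)
    (solve 2 (λ p q → q :+ (p :- q) := p) refl p q)
    (+-monoʳ-≤ q (≤-trans (p≤∣p∣ (p - q)) h))
    where open +-*-Solver

  ∣p-p∣≤r : ∀ p {r} → 0ℚ < r → ∣ p - p ∣ ≤ r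
  ∣p-p∣≤r p {r} 0<r = subst (λ z → ∣ z ∣ ≤ r) (sym (+-inverseʳ p)) (<⇒≤ 0<r)

  p≤p+q : ∀ p {q} → 0ℚ ≤ q → p ≤ p + q
  p≤p+q p {q} 0≤q = subst (_≤ p + q) (+-identityʳ p) (+-monoʳ-≤ p 0≤q)

  +-pos : ∀ {p q} → 0ℚ < p → 0ℚ ≤ q → 0ℚ < p + q
  +-pos a b = +-mono-<-≤ a b

  *-pos : ∀ {p q} → 0ℚ < p → 0ℚ < q → 0ℚ < p * q
  *-pos {p} {q} a b = positive⁻¹ (p * q) {{pos*pos⇒pos p {{positive a}} q {{positive b}}}}

  *-nonneg : ∀ {p q} → 0ℚ ≤ p → 0ℚ ≤ q → 0ℚ ≤ p * q
  *-nonneg {p} {q} a b =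
    nonNegative⁻¹ (p * q) {{nonNeg*nonNeg⇒nonNeg p {{nonNegative a}} q {{nonNegative b}}}}

  *-mono : ∀ {p q r s} → 0ℚ ≤ q → 0ℚ ≤ r → p ≤ q → r ≤ s → p * r ≤ q * s
  *-mono {p} {q} {r} {s} 0≤q 0≤r a b =
    ≤-trans (*-monoʳ-≤-nonNeg r {{nonNegative 0≤r}} a) (*-monoˡ-≤-nonNeg q {{nonNegative 0≤q}} b)

  square-cancel-≤ : ∀ {p q} → 0ℚ ≤ q → p * p ≤ q * q → p ≤ q
  square-cancel-≤ {p} {q} 0≤q h with p ≤? q
  ... | yes p≤q = p≤q
  ... | no  p≰q = contradiction h (<⇒≱′ (≤-<-trans
        (*-monoˡ-≤-nonNeg q {{nonNegative 0≤q}} (<⇒≤ q<p))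
        (*-monoˡ-<-pos p {{positive (≤-<-trans 0≤q q<p)}} q<p)))
    where
    q<p = ≰⇒> p≰q
    <⇒≱′ : ∀ {x y} → x < y → ¬ (y ≤ x)
    <⇒≱′ x<y y≤x = <-irrefl refl (<-≤-trans x<y y≤x)

  half : ℚ → ℚ
  half ε = ½ * ε

  half-pos : ∀ {ε} → 0ℚ < ε → 0ℚ < half ε
  half-pos = *-pos (toWitness {a? = 0ℚ <? ½} _)

  half+half : ∀ ε → half ε + half ε ≡ ε
  half+half ε = trans (sym (*-distribʳ-+ ε ½ ½)) (*-identityˡ ε)

  -- ε divided by a positive bound.
  split : ∀ b ε → 0ℚ < b → 0ℚ < ε → ∃[ η ] 0ℚ < η × b * η ≡ ε
  split b ε 0<b 0<ε = b⁻¹ * ε , *-pos (positive⁻¹ b⁻¹ {{1/pos⇒pos b {{positive 0<b}}}}) 0<ε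
    , trans (sym (*-assoc b b⁻¹ ε)) (trans (cong (_* ε) (*-inverseʳ b {{nz}})) (*-identityˡ ε))
    where
    nz : NonZero b
    nz = pos⇒nonZero b {{positive 0<b}}
    b⁻¹ = (1/ b) {{nz}}

  *-difference : ∀ a b c d {A B η} → 0ℚ ≤ η → ∣ a ∣ ≤ A → ∣ d ∣ ≤ B →
    ∣ a - c ∣ ≤ η → ∣ b - d ∣ ≤ η → ∣ a * b - c * d ∣ ≤ (A + B) * η
  *-difference a b c d {A} {B} {η} 0≤η a≤A d≤B ac bd = begin
    ∣ a * b - c * d ∣                     ≡⟨ cong ∣_∣ (solve 4 (λ a b c d → a :* b :- c :* d := a :* (b :- d) :+ d :* (a :- c)) refl a b c d) ⟩
    ∣ a * (b - d) + d * (a - c) ∣         ≤⟨ ∣p+q∣≤∣p∣+∣q∣ (a * (b - d)) (d * (a - c)) ⟩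
    ∣ a * (b - d) ∣ + ∣ d * (a - c) ∣     ≡⟨ cong₂ _+_ (∣p*q∣≡∣p∣*∣q∣ a (b - d)) (∣p*q∣≡∣p∣*∣q∣ d (a - c)) ⟩
    ∣ a ∣ * ∣ b - d ∣ + ∣ d ∣ * ∣ a - c ∣ ≤⟨ +-mono-≤
                                              (*-mono (≤-trans (0≤∣p∣ a) a≤A) (0≤∣p∣ (b - d)) a≤A bd)
                                              (*-mono (≤-trans (0≤∣p∣ d) d≤B) (0≤∣p∣ (a - c)) d≤B ac) ⟩
    A * η + B * η                         ≡⟨ sym (*-distribʳ-+ η A B) ⟩
    (A + B) * η                           ∎
    where open ≤-Reasoning
          open +-*-Solver

  +-difference : ∀ a b c d {ε} → ∣ a - c ∣ ≤ half ε → ∣ b - d ∣ ≤ half ε → ∣ (a + b) - (c + d) ∣ ≤ ε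
  +-difference a b c d {ε} ac bd = begin
    ∣ (a + b) - (c + d) ∣   ≡⟨ cong ∣_∣ (solve 4 (λ a b c d → a :+ b :- (c :+ d) := (a :- c) :+ (b :- d)) refl a b c d) ⟩
    ∣ (a - c) + (b - d) ∣   ≤⟨ ∣p+q∣≤∣p∣+∣q∣ (a - c) (b - d) ⟩
    ∣ a - c ∣ + ∣ b - d ∣   ≤⟨ +-mono-≤ ac bd ⟩
    half ε + half ε         ≡⟨ half+half ε ⟩
    ε                       ∎
    where open ≤-Reasoning
          open +-*-Solver

  neg-difference : ∀ a c {ε} → ∣ a - c ∣ ≤ ε → ∣ - a - (- c) ∣ ≤ ε
  neg-difference a c {ε} h = subst (_≤ ε)
    (trans (sym (∣-p∣≡∣p∣ (a - c))) (cong ∣_∣ (solve 2 (λ a c → :- (a :- c) := :- a :- (:- c)) refl a c))) h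
    where open +-*-Solver

  step : ℕ → ℚ
  step k = + 1 / suc k

  grid : ℕ → ℕ → ℚ
  grid k j = + j / suc k

  nonneg-/ : ∀ j k → 0ℚ ≤ + j / suc k
  nonneg-/ j k = nonNegative⁻¹ _ {{normalize-nonNeg j (suc k)}}

  grid-suc-ℤ : ∀ k j → + suc j ℤ.* + (suc k ℕ.* suc k) ≡ (+ j ℤ.* + suc k ℤ.+ + 1 ℤ.* + suc k) ℤ.* + suc k
  grid-suc-ℤ k j = begin
    + suc j ℤ.* + (suc k ℕ.* suc k)                    ≡⟨ cong (+ suc j ℤ.*_) (ℤₚ.pos-* (suc k) (suc k)) ⟩
    + suc j ℤ.* (+ suc k ℤ.* + suc k)                  ≡⟨ ℤₚ.*-assoc (+ suc j) (+ suc k) (+ suc k) ⟨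
    + suc j ℤ.* + suc k ℤ.* + suc k                    ≡⟨ cong (λ i → + i ℤ.* + suc k ℤ.* + suc k) (ℕₚ.+-comm 1 j) ⟩
    (+ j ℤ.+ + 1) ℤ.* + suc k ℤ.* + suc k              ≡⟨ cong (ℤ._* + suc k) (ℤₚ.*-distribʳ-+ (+ suc k) (+ j) (+ 1)) ⟩
    (+ j ℤ.* + suc k ℤ.+ + 1 ℤ.* + suc k) ℤ.* + suc k  ∎
    where open ≡-Reasoning

  grid-suc : ∀ k j → grid k (suc j) ≡ grid k j + step k
  grid-suc k j = toℚᵘ-injective (begin
    toℚᵘ (grid k (suc j))                ≈⟨ toℚᵘ-fromℚᵘ (ℚᵘ.mkℚᵘ (+ suc j) k) ⟩
    ℚᵘ.mkℚᵘ (+ suc j) k                  ≈⟨ ℚᵘ.*≡* (grid-suc-ℤ k j) ⟩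
    ℚᵘ.mkℚᵘ (+ j) k ℚᵘ.+ ℚᵘ.mkℚᵘ (+ 1) k ≈⟨ ℚᵘₚ.+-cong (toℚᵘ-fromℚᵘ (ℚᵘ.mkℚᵘ (+ j) k)) (toℚᵘ-fromℚᵘ (ℚᵘ.mkℚᵘ (+ 1) k)) ⟨
    toℚᵘ (grid k j) ℚᵘ.+ toℚᵘ (step k)   ≈⟨ toℚᵘ-homo-+ (grid k j) (step k) ⟨
    toℚᵘ (grid k j + step k)             ∎)
    where open ℚᵘₚ.≃-Reasoning

  p≤numerator : ∀ p → p ≤ + ℤ.∣ ↥ p ∣ / 1
  p≤numerator p@(mkℚ n d-1 _) = toℚᵘ-cancel-≤ (ℚᵘₚ.≤-respʳ-≃
    (ℚᵘₚ.≃-sym (toℚᵘ-fromℚᵘ (ℚᵘ.mkℚᵘ (+ ℤ.∣ n ∣) 0))) (ℚᵘ.*≤* le))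
    where
    n≤∣n∣ : ∀ i → i ℤ.≤ + ℤ.∣ i ∣
    n≤∣n∣ (+ _)      = ℤₚ.≤-refl
    n≤∣n∣ ℤ.-[1+ _ ] = ℤ.-≤+
    le : n ℤ.* + 1 ℤ.≤ + ℤ.∣ n ∣ ℤ.* + suc d-1
    le = ℤₚ.≤-trans (subst (ℤ._≤ + ℤ.∣ n ∣) (sym (ℤₚ.*-identityʳ n)) (n≤∣n∣ n))
      (subst (+ ℤ.∣ n ∣ ℤ.≤_) (ℤₚ.pos-* ℤ.∣ n ∣ (suc d-1)) (ℤ.+≤+ (ℕₚ.m≤m*n ℤ.∣ n ∣ (suc d-1))))

  step≤ : ∀ {ε n} → 0ℚ < ε → ↧ₙ ε ℕ.≤ n → step n ≤ ε
  step≤ {mkℚ (+ zero) d-1 _} {n} (*<* (ℤ.+<+ ())) h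
  step≤ {ε@(mkℚ (+ suc m) d-1 _)} {n} 0<ε h = toℚᵘ-cancel-≤ (ℚᵘₚ.≤-respˡ-≃
    (ℚᵘₚ.≃-sym (toℚᵘ-fromℚᵘ (ℚᵘ.mkℚᵘ (+ 1) n))) (ℚᵘ.*≤* le))
    where
    le : + 1 ℤ.* + suc d-1 ℤ.≤ + suc m ℤ.* + suc n
    le = subst₂ ℤ._≤_ (ℤₚ.pos-* 1 (suc d-1)) (ℤₚ.pos-* (suc m) (suc n))
      (ℤ.+≤+ (ℕₚ.*-mono-≤ (ℕ.s≤s (ℕ.z≤n {m})) (ℕₚ.≤-trans h (ℕₚ.n≤1+n n))))

  numerator-grid : ∀ M k → grid k (M ℕ.* suc k) ≡ + M / 1
  numerator-grid M k = toℚᵘ-injective (ℚᵘₚ.≃-trans (toℚᵘ-fromℚᵘ (ℚᵘ.mkℚᵘ (+ (M ℕ.* suc k)) k))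
    (ℚᵘₚ.≃-trans (ℚᵘ.*≡* (trans (ℤₚ.*-identityʳ _) (ℤₚ.pos-* M (suc k))))
      (ℚᵘₚ.≃-sym (toℚᵘ-fromℚᵘ (ℚᵘ.mkℚᵘ (+ M) 0)))))

  -- The largest j ≤ b with (g j)² ≤ p, or 0 if there is none.
  root : (ℕ → ℚ) → ℚ → ℕ → ℕ
  root g p zero = zero
  root g p (suc j) with g (suc j) * g (suc j) ≤? p
  ... | yes _ = suc j
  ... | no  _ = root g p j

  root-lower : ∀ (g : ℕ → ℚ) p b → (root g p b ≡ 0) ⊎ (g (root g p b) * g (root g p b) ≤ p)
  root-lower g p zero = inj₁ refl
  root-lower g p (suc b) with g (suc b) * g (suc b) ≤? p
  ... | yes h = inj₂ h
  ... | no  _ = root-lower g p b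

  root-upper : ∀ (g : ℕ → ℚ) p b → p < g (suc b) * g (suc b) →
    p < g (suc (root g p b)) * g (suc (root g p b))
  root-upper g p zero h = h
  root-upper g p (suc b) h with g (suc b) * g (suc b) ≤? p
  ... | yes _ = h
  ... | no  ¬h = root-upper g p b (≰⇒> ¬h)

  -- The search bound suffices since p < (∣↥p∣ + 1)².
  rootBound : ℚ → ℕ → ℕ
  rootBound p k = suc ℤ.∣ ↥ p ∣ ℕ.* suc k

  -- The square root of max(p, 0), rounded down to a multiple of 1/(k+1).
  √ℚ : ℚ → ℕ → ℚ
  √ℚ p k = grid k (root (grid k) p (rootBound p k))

  √ℚ-nonneg : ∀ p k → 0ℚ ≤ √ℚ p k
  √ℚ-nonneg p k = nonneg-/ (root (grid k) p (rootBound p k)) k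

  √ℚ-lower : ∀ p k → (√ℚ p k ≡ 0ℚ) ⊎ (√ℚ p k * √ℚ p k ≤ p)
  √ℚ-lower p k = [ (λ e → inj₁ (trans (cong (grid k) e) (0/n≡0 (suc k)))) , inj₂ ]′
    (root-lower (grid k) p (rootBound p k))

  √ℚ-upper : ∀ p k → p < (√ℚ p k + step k) * (√ℚ p k + step k)
  √ℚ-upper p k = subst (λ z → p < z * z) (grid-suc k (root (grid k) p b)) (root-upper (grid k) p b bound)
    where
    b = rootBound p k
    N = + ℤ.∣ ↥ p ∣ / 1
    M = + suc ℤ.∣ ↥ p ∣ / 1
    M≡ : M ≡ N + 1ℚ
    M≡ = grid-suc 0 ℤ.∣ ↥ p ∣
    0≤N : 0ℚ ≤ N
    0≤N = nonneg-/ ℤ.∣ ↥ p ∣ 0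
    1≤M : 1ℚ ≤ M
    1≤M = subst (1ℚ ≤_) (trans (+-comm 1ℚ N) (sym M≡)) (p≤p+q 1ℚ 0≤N)
    0≤1 : 0ℚ ≤ 1ℚ
    0≤1 = toWitness {a? = 0ℚ ≤? 1ℚ} _
    M≤ : M ≤ grid k (suc b)
    M≤ = subst₂ _≤_ (numerator-grid (suc ℤ.∣ ↥ p ∣) k) (sym (grid-suc k b))
      (p≤p+q (grid k b) (nonneg-/ 1 k))
    bound : p < grid k (suc b) * grid k (suc b)
    bound = begin-strict
      p         ≤⟨ p≤numerator p ⟩
      N         ≡⟨ sym (+-identityʳ N) ⟩
      N + 0ℚ    <⟨ +-monoʳ-< N (toWitness {a? = 0ℚ <? 1ℚ} _) ⟩
      N + 1ℚ    ≡⟨ sym M≡ ⟩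
      M         ≡⟨ sym (*-identityʳ M) ⟩
      M * 1ℚ    ≤⟨ *-mono (≤-trans 0≤1 (≤-trans 1≤M M≤)) 0≤1 M≤ (≤-trans 1≤M M≤) ⟩
      grid k (suc b) * grid k (suc b) ∎
      where open ≤-Reasoning

  root-close : ∀ {p q r s t ε} → 0ℚ ≤ r → 0ℚ ≤ s → 0ℚ < ε → s ≤ half ε →
    p ≤ q + half ε * half ε → t * t ≤ p → q < (r + s) * (r + s) → t ≤ r + ε
  root-close {p} {q} {r} {s} {t} {ε} 0≤r 0≤s 0<ε s≤η h lower upper =
    square-cancel-≤ (≤-trans 0≤r (p≤p+q r 0≤ε)) (begin
      t * t                                             ≤⟨ lower ⟩
      p                                                 ≤⟨ h ⟩
      q + η * η                                         ≤⟨ +-monoˡ-≤ (η * η) (<⇒≤ upper) ⟩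
      (r + s) * (r + s) + η * η                         ≤⟨ +-monoˡ-≤ (η * η) (*-mono 0≤r+η 0≤r+s r+s≤ r+s≤) ⟩
      (r + η) * (r + η) + η * η                         ≤⟨ p≤p+q _ (*-nonneg (+-mono-≤ 0≤r 0≤r) 0≤η) ⟩
      (r + η) * (r + η) + η * η + (r + r) * η
        ≡⟨ solve 2 (λ r η → (r :+ η) :* (r :+ η) :+ η :* η :+ (r :+ r) :* η
                         := r :* (r :+ (η :+ η)) :+ (η :+ η) :* (r :+ η)) refl r η ⟩
      r * (r + (η + η)) + (η + η) * (r + η)             ≤⟨ +-monoʳ-≤ (r * (r + (η + η)))
                                                            (*-monoˡ-≤-nonNeg (η + η) {{nonNegative (+-mono-≤ 0≤η 0≤η)}}
                                                              (+-monoʳ-≤ r (p≤p+q η 0≤η))) ⟩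
      r * (r + (η + η)) + (η + η) * (r + (η + η))       ≡⟨ *-distribʳ-+ (r + (η + η)) r (η + η) ⟨
      (r + (η + η)) * (r + (η + η))                     ≡⟨ cong (λ z → (r + z) * (r + z)) (half+half ε) ⟩
      (r + ε) * (r + ε)                                 ∎)
    where
    open ≤-Reasoning
    open +-*-Solver
    η = half ε
    0≤ε = <⇒≤ 0<ε
    0≤η = <⇒≤ (half-pos 0<ε)
    r+s≤ = +-monoʳ-≤ r s≤η
    0≤r+η = ≤-trans 0≤r (p≤p+q r 0≤η)
    0≤r+s = ≤-trans 0≤r (p≤p+q r 0≤s)

  √ℚ-close : ∀ {p q ε} m n → 0ℚ < ε → step n ≤ half ε → p ≤ q + half ε * half ε →
    √ℚ p m ≤ √ℚ q n + ε
  √ℚ-close {p} {q} {ε} m n 0<ε st h =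
    [ (λ e → subst (_≤ √ℚ q n + ε) (sym e) (≤-trans 0≤r (p≤p+q (√ℚ q n) (<⇒≤ 0<ε))))
    , (λ lower → root-close {s = step n} 0≤r (nonneg-/ 1 n) 0<ε st h lower (√ℚ-upper q n))
    ]′ (√ℚ-lower p m)
    where
    0≤r = √ℚ-nonneg q n

  ∣∣-close : ∀ a b {c} → ∣ b - a ∣ ≤ c → ∣ a ∣ ≤ c → ∣ b ∣ ≤ c + c
  ∣∣-close a b {c} h k = begin
    ∣ b ∣               ≡⟨ cong ∣_∣ (solve 2 (λ a b → b := (b :- a) :+ a) refl a b) ⟩
    ∣ (b - a) + a ∣     ≤⟨ ∣p+q∣≤∣p∣+∣q∣ (b - a) a ⟩
    ∣ b - a ∣ + ∣ a ∣   ≤⟨ +-mono-≤ h k ⟩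
    c + c               ∎
    where open ≤-Reasoning
          open +-*-Solver

  square-gap : ∀ {q r s B η} → 0ℚ ≤ r → 0ℚ ≤ s → r ≤ B → s ≤ 1ℚ → s ≤ η →
    q < (r + s) * (r + s) → q ≤ r * r + (B + B + 1ℚ) * η
  square-gap {q} {r} {s} {B} {η} 0≤r 0≤s r≤B s≤1 s≤η h = begin
    q                             ≤⟨ <⇒≤ h ⟩
    (r + s) * (r + s)             ≡⟨ solve 2 (λ r s → (r :+ s) :* (r :+ s) := r :* r :+ (r :+ r :+ s) :* s) refl r s ⟩
    r * r + (r + r + s) * s       ≤⟨ +-monoʳ-≤ (r * r) (*-mono (≤-trans 0≤b b≤) 0≤s b≤ s≤η) ⟩
    r * r + (B + B + 1ℚ) * η      ∎
    where
    open ≤-Reasoning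
    open +-*-Solver
    0≤b = +-mono-≤ (+-mono-≤ 0≤r 0≤r) 0≤s
    b≤ = +-mono-≤ (+-mono-≤ r≤B r≤B) s≤1

open RationalLemmas

SettlesWithin : (ℕ → ℚ) → ℚ → Set
SettlesWithin f ε = ∃[ N ] (∀ m n → N ℕ.≤ m → N ℕ.≤ n → ℚ.∣ f m ℚ.- f n ∣ ℚ.≤ ε)

-- Cauchy sequences of rationals; equality of reals is _≃ᴿ_ below.
record ℝ : Set where
  field
    seq    : ℕ → ℚ
    cauchy : ∀ ε → 0ℚ ℚ.< ε → SettlesWithin seq ε

open ℝ public

infix  4 _≃ᴿ_ _≤ᴿ_ _<ᴿ_
infixl 6 _+ᴿ_ _-ᴿ_
infixl 7 _*ᴿ_
infix  8 -ᴿ_ √_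

_≃ᴿ_ _≤ᴿ_ _<ᴿ_ : ℝ → ℝ → Set
x ≃ᴿ y = ∀ ε → 0ℚ ℚ.< ε → ∃[ N ] (∀ n → N ℕ.≤ n → ℚ.∣ seq x n ℚ.- seq y n ∣ ℚ.≤ ε)
x ≤ᴿ y = ∀ ε → 0ℚ ℚ.< ε → ∃[ N ] (∀ n → N ℕ.≤ n → seq x n ℚ.≤ seq y n ℚ.+ ε)
x <ᴿ y = ∃[ ε ] 0ℚ ℚ.< ε × ∃[ N ] (∀ n → N ℕ.≤ n → seq x n ℚ.+ ε ℚ.≤ seq y n)

fromℚ : ℚ → ℝ
fromℚ q .seq _ = q
fromℚ q .cauchy ε 0<ε = 0 , λ _ _ _ _ → ∣p-p∣≤r q 0<ε

_+ᴿ_ : ℝ → ℝ → ℝ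
(x +ᴿ y) .seq n = seq x n ℚ.+ seq y n
(x +ᴿ y) .cauchy ε 0<ε
  with M , hx ← cauchy x (half ε) (half-pos 0<ε)
     | N , hy ← cauchy y (half ε) (half-pos 0<ε)
  = M ℕ.⊔ N , λ m n M⊔N≤m M⊔N≤n → +-difference (seq x m) (seq y m) (seq x n) (seq y n)
      (hx m n (ℕₚ.m⊔n≤o⇒m≤o M N M⊔N≤m) (ℕₚ.m⊔n≤o⇒m≤o M N M⊔N≤n))
      (hy m n (ℕₚ.m⊔n≤o⇒n≤o M N M⊔N≤m) (ℕₚ.m⊔n≤o⇒n≤o M N M⊔N≤n))

-ᴿ_ : ℝ → ℝ
(-ᴿ x) .seq n = ℚ.- seq x n
(-ᴿ x) .cauchy ε 0<ε with N , h ← cauchy x ε 0<ε =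
  N , λ m n N≤m N≤n → neg-difference (seq x m) (seq x n) (h m n N≤m N≤n)

_-ᴿ_ : ℝ → ℝ → ℝ
x -ᴿ y = x +ᴿ (-ᴿ y)

Bounded : (ℕ → ℚ) → Set
Bounded f = ∃[ B ] 0ℚ ℚ.< B × ∃[ N ] (∀ n → N ℕ.≤ n → ℚ.∣ f n ∣ ℚ.≤ B)

bounded : ∀ x → Bounded (seq x)
bounded x with N , h ← cauchy x 1ℚ (toWitness {a? = 0ℚ ℚ.<? 1ℚ} _) =
  c ℚ.+ c , +-pos 0<c (ℚₚ.<⇒≤ 0<c) , N , λ n N≤n → ∣∣-close (seq x N) (seq x n)
    (ℚₚ.≤-trans (h n N N≤n ℕₚ.≤-refl) (p≤p+q 1ℚ (ℚₚ.0≤∣p∣ (seq x N))))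
    (subst (ℚ.∣ seq x N ∣ ℚ.≤_) (ℚₚ.+-comm ℚ.∣ seq x N ∣ 1ℚ)
      (p≤p+q ℚ.∣ seq x N ∣ (toWitness {a? = 0ℚ ℚ.≤? 1ℚ} _)))
  where
  c = 1ℚ ℚ.+ ℚ.∣ seq x N ∣
  0<c = +-pos (toWitness {a? = 0ℚ ℚ.<? 1ℚ} _) (ℚₚ.0≤∣p∣ (seq x N))

_*ᴿ_ : ℝ → ℝ → ℝ
(x *ᴿ y) .seq n = seq x n ℚ.* seq y n
(x *ᴿ y) .cauchy ε 0<ε = combine (bounded x) (bounded y)
  where
  -- Helper functions, as 'with' would normalise the proofs it abstracts over.
  combine : Bounded (seq x) → Bounded (seq y) → SettlesWithin (λ n → seq x n ℚ.* seq y n) ε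
  combine (A , 0<A , K , hA) (B , 0<B , L , hB) = choose (split (A ℚ.+ B) ε (+-pos 0<A (ℚₚ.<⇒≤ 0<B)) 0<ε)
    where
    choose : ∃[ η ] 0ℚ ℚ.< η × (A ℚ.+ B) ℚ.* η ≡ ε → _
    choose (η , 0<η , e) = finish (cauchy x η 0<η) (cauchy y η 0<η)
      where
      finish : SettlesWithin (seq x) η → SettlesWithin (seq y) η → _
      finish (M , hx) (N , hy) = (K ℕ.⊔ L) ℕ.⊔ (M ℕ.⊔ N) , λ m n P≤m P≤n →
        subst (ℚ.∣ seq x m ℚ.* seq y m ℚ.- seq x n ℚ.* seq y n ∣ ℚ.≤_) e
          (*-difference (seq x m) (seq y m) (seq x n) (seq y n) (ℚₚ.<⇒≤ 0<η)
            (hA m (ℕₚ.m⊔n≤o⇒m≤o K L (KL P≤m)))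
            (hB n (ℕₚ.m⊔n≤o⇒n≤o K L (KL P≤n)))
            (hx m n (ℕₚ.m⊔n≤o⇒m≤o M N (MN P≤m)) (ℕₚ.m⊔n≤o⇒m≤o M N (MN P≤n)))
            (hy m n (ℕₚ.m⊔n≤o⇒n≤o M N (MN P≤m)) (ℕₚ.m⊔n≤o⇒n≤o M N (MN P≤n))))
        where
        KL : ∀ {p} → (K ℕ.⊔ L) ℕ.⊔ (M ℕ.⊔ N) ℕ.≤ p → K ℕ.⊔ L ℕ.≤ p
        KL = ℕₚ.m⊔n≤o⇒m≤o (K ℕ.⊔ L) (M ℕ.⊔ N)
        MN : ∀ {p} → (K ℕ.⊔ L) ℕ.⊔ (M ℕ.⊔ N) ℕ.≤ p → M ℕ.⊔ N ℕ.≤ p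
        MN = ℕₚ.m⊔n≤o⇒n≤o (K ℕ.⊔ L) (M ℕ.⊔ N)

-- Negative arguments are truncated to 0 by √ℚ.
√_ : ℝ → ℝ
(√ x) .seq n = √ℚ (seq x n) n
(√ x) .cauchy ε 0<ε = combine (cauchy x (half ε ℚ.* half ε) (*-pos (half-pos 0<ε) (half-pos 0<ε)))
  where
  K = ℚ.↧ₙ half ε
  combine : SettlesWithin (seq x) (half ε ℚ.* half ε) → SettlesWithin (λ n → √ℚ (seq x n) n) ε
  combine (N , h) = N ℕ.⊔ K , λ m n P≤m P≤n → ∣p-q∣≤r (√ℚ (seq x m) m) (√ℚ (seq x n) n)
    (close m n (ℕₚ.m⊔n≤o⇒m≤o N K P≤m) (ℕₚ.m⊔n≤o⇒m≤o N K P≤n) (ℕₚ.m⊔n≤o⇒n≤o N K P≤n))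
    (close n m (ℕₚ.m⊔n≤o⇒m≤o N K P≤n) (ℕₚ.m⊔n≤o⇒m≤o N K P≤m) (ℕₚ.m⊔n≤o⇒n≤o N K P≤m))
    where
    close : ∀ m n → N ℕ.≤ m → N ℕ.≤ n → K ℕ.≤ n → √ℚ (seq x m) m ℚ.≤ √ℚ (seq x n) n ℚ.+ ε
    close m n N≤m N≤n K≤n = √ℚ-close {seq x m} {seq x n} m n 0<ε (step≤ {half ε} (half-pos 0<ε) K≤n)
      (∣p-q∣≤r⇒p≤q+r (seq x m) (seq x n) (h m n N≤m N≤n))

√-nonneg : ∀ x → fromℚ 0ℚ ≤ᴿ √ x
√-nonneg x ε 0<ε = 0 , λ n _ → ℚₚ.≤-trans (√ℚ-nonneg (seq x n) n) (p≤p+q (√ℚ (seq x n) n) (ℚₚ.<⇒≤ 0<ε))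

√-square : ∀ x → fromℚ 0ℚ ≤ᴿ x → √ x *ᴿ √ x ≃ᴿ x
√-square x 0≤x ε 0<ε = combine (bounded (√ x)) (0≤x ε 0<ε)
  where
  combine : Bounded (seq (√ x)) → ∃[ M ] (∀ n → M ℕ.≤ n → 0ℚ ℚ.≤ seq x n ℚ.+ ε) → _
  combine (B , 0<B , L , hB) (M , hM) = finish (split b ε 0<b 0<ε)
    where
    b = B ℚ.+ B ℚ.+ 1ℚ
    0<b : 0ℚ ℚ.< b
    0<b = +-pos (+-pos 0<B (ℚₚ.<⇒≤ 0<B)) (toWitness {a? = 0ℚ ℚ.≤? 1ℚ} _)
    finish : ∃[ η ] 0ℚ ℚ.< η × b ℚ.* η ≡ ε → _
    finish (η , 0<η , e) = (L ℕ.⊔ M) ℕ.⊔ (1 ℕ.⊔ K) , λ n P≤n → ∣p-q∣≤r (√ℚ (seq x n) n ℚ.* √ℚ (seq x n) n) (seq x n)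
      (upper n (ℕₚ.m⊔n≤o⇒n≤o L M (LM P≤n)))
      (lower n (ℕₚ.m⊔n≤o⇒m≤o L M (LM P≤n)) (ℕₚ.m⊔n≤o⇒m≤o 1 K (1K P≤n)) (ℕₚ.m⊔n≤o⇒n≤o 1 K (1K P≤n)))
      where
      K = ℚ.↧ₙ η
      LM : ∀ {n} → (L ℕ.⊔ M) ℕ.⊔ (1 ℕ.⊔ K) ℕ.≤ n → L ℕ.⊔ M ℕ.≤ n
      LM = ℕₚ.m⊔n≤o⇒m≤o (L ℕ.⊔ M) (1 ℕ.⊔ K)
      1K : ∀ {n} → (L ℕ.⊔ M) ℕ.⊔ (1 ℕ.⊔ K) ℕ.≤ n → 1 ℕ.⊔ K ℕ.≤ n
      1K = ℕₚ.m⊔n≤o⇒n≤o (L ℕ.⊔ M) (1 ℕ.⊔ K)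
      upper : ∀ n → M ℕ.≤ n → √ℚ (seq x n) n ℚ.* √ℚ (seq x n) n ℚ.≤ seq x n ℚ.+ ε
      upper n M≤n =
        [ (λ r≡0 → subst (λ z → z ℚ.* z ℚ.≤ seq x n ℚ.+ ε) (sym r≡0) (hM n M≤n))
        , (λ r²≤p → ℚₚ.≤-trans r²≤p (p≤p+q (seq x n) (ℚₚ.<⇒≤ 0<ε)))
        ]′ (√ℚ-lower (seq x n) n)
      lower : ∀ n → L ℕ.≤ n → 1 ℕ.≤ n → K ℕ.≤ n →
        seq x n ℚ.≤ √ℚ (seq x n) n ℚ.* √ℚ (seq x n) n ℚ.+ ε
      lower n L≤n 1≤n K≤n = subst (λ z → seq x n ℚ.≤ √ℚ (seq x n) n ℚ.* √ℚ (seq x n) n ℚ.+ z) e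
        (square-gap {seq x n} {√ℚ (seq x n) n} {step n} {B} {η} (√ℚ-nonneg (seq x n) n) (nonneg-/ 1 n)
          (ℚₚ.≤-trans (p≤∣p∣ (√ℚ (seq x n) n)) (hB n L≤n))
          (step≤ {1ℚ} (toWitness {a? = 0ℚ ℚ.<? 1ℚ} _) 1≤n)
          (step≤ {η} 0<η K≤n)
          (√ℚ-upper (seq x n) n))

-- An extended real v in [-∞, +∞] is given by the set of rationals q < v.
-- A cut, unlike a Cauchy sequence, can be formed for the minimum of a
-- finite set of rationals that is not given by a decidable predicate, and
-- for a limit inferior with no known modulus of convergence.
LowerCut : Set₁
LowerCut = ℚ → Set

_≥ᴸ_ : LowerCut → ℝ → Set
L ≥ᴸ x = ∀ q → fromℚ q <ᴿ x → L q

infix 4 _≥ᴸ_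

-- The strict bound makes this the cut of a minimum only when f takes
-- finitely many values on P; the minimum of an empty family is +∞.
minimum : {I : Set} → (I → Set) → (I → ℚ) → LowerCut
minimum P f q = ∀ i → P i → q ℚ.< f i

-- sup over N of inf over n ≥ N: q lies strictly below this supremum iff
-- some r > q is a lower bound of all terms from some N on.
liminf : (ℕ → LowerCut) → LowerCut
liminf L q = ∃[ r ] q ℚ.< r × ∃[ N ] (∀ n → N ℕ.≤ n → L n r)

open import Data.Fin.Subset using (Subset; inside; outside; ∣_∣)
open import Data.Fin.Subset.Properties using (_⊆?_)

-- A d-system on the vertex set Fin n.
record System (d n : ℕ) : Set where
  field
    mem  : Subset n → Bool
    size : ∀ {S} → T (mem S) → ∣ S ∣ ≡ d

open System public

infix 4 _≐_

_≐_ : ∀ {d n} → System d n → System d n → Set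
E ≐ F = ∀ S → mem E S ≡ mem F S

-- Every subset of Fin n, listed exactly once.
subsets : ∀ n → List (Subset n)
subsets zero    = Vec.[] ∷ []
subsets (suc n) = map (inside Vec.∷_) (subsets n) ++ map (outside Vec.∷_) (subsets n)

card : ∀ {d n} → System d n → ℕ
card {n = n} E = length (filter (λ S → T? (mem E S)) (subsets n))

-- The value at denominator 0 is junk: it only concerns densities of
-- d-systems on fewer than d vertices.
ratio : ℕ → ℕ → ℚ
ratio a zero    = 0ℚ
ratio a (suc b) = + a / suc b

‖_‖ : ∀ {d n} → System d n → ℚ
‖_‖ {d} {n} E = ratio (card E) (n C d)

cardWithin : ∀ {d n} → System d n → Subset n → ℕ
cardWithin {n = n} E U = length (filter (λ S → T? (mem E S) ×-dec S ⊆? U) (subsets n))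

δ-mem? : ∀ {d n} (E : System d n) (U : Subset n) →
         Dec (∣ U ∣ ≡ suc d × parity (cardWithin E U) ≡ 1ℙ)
δ-mem? {d} E U = (∣ U ∣ ℕₚ.≟ suc d) ×-dec (parity (cardWithin E U) ℙₚ.≟ 1ℙ)

δ : ∀ {d n} → System d n → System (suc d) n
δ E .mem U        = ⌊ δ-mem? E U ⌋
δ E .size {U} U∈δE = proj₁ (toWitness {a? = δ-mem? E U} U∈δE)

Minimal : ∀ {d n} → System d n → Set
Minimal {d} {n} E = (E′ : System d n) → δ E ≐ δ E′ → ‖ E ‖ ℚ.≤ ‖ E′ ‖

φ : ℕ → ℝ → LowerCut
φ d α = liminf λ n →
  minimum {System d n} (λ E → Minimal E × α ≤ᴿ fromℚ ‖ E ‖) (λ E → ‖ δ E ‖)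

{-# OPTIONS --safe #-}
module Submission where

-- Let A be the adjacency matrix of a minimal graph E on n vertices, and sum
-- over ordered tuples of vertices, with repetitions: e = Σ A_xy = 2|E| and
-- T = 6|δE|. Minimality says that every cut contains at most half of its
-- pairs. The cuts around the neighbourhoods N(x) give ne ≤ T. For an edge xy
-- let X_xy be the number of vertices, those adjacent to exactly one end
-- counted 3 times and those adjacent to both ends counted twice; then
-- K = Σ A_xy X_xy = 3ne − T. The cuts around N(x) ∩ N(y), x and y not
-- adjacent, give 2 Σ A_xy X_xy² ≤ 3nK + 9e²: after symmetrisation this is an
-- inequality that holds for each graph on four vertices. (Repeated vertices
-- do no harm: they are twins, and not adjacent.) By Cauchy–Schwarz
-- 2K² ≤ e(3nK + 9e²), that is, (3ne − T)(3ne − 2T) ≤ 9e³. Together with ne ≤ T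
-- this gives T ≥ ¾ b (3 − √(8b + 1)) n³ whenever 0 ≤ bn² ≤ e.

open import Defs
open import Data.Integer.Base using (+_)
open import Data.Rational using (0ℚ; _/_)
import Algebra.Properties.Semiring.Sum as SemiringSum
open import Data.Product.Base using (∃-syntax; _×_; _,_)
open import Relation.Binary.PropositionalEquality
open import Relation.Nullary using (Dec; yes; no)
open import Relation.Nullary.Decidable using (toWitness)

-- Sums over vertices, and weights of graphs on four vertices.

module GraphInequality where
  open import Data.Bool.Base using (Bool; true; false; _∧_; _xor_)
  open import Data.Fin.Base using (Fin; zero; suc)
  open import Data.Integer.Base hiding (suc)
  open import Data.Integer.Properties
  open import Data.Integer.Solver using (module +-*-Solver)
  open import Data.Nat.Base as ℕ using (ℕ; zero; suc)
  open import Relation.Nullary using (Dec)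
  open import Relation.Nullary.Decidable using (map′; _×-dec_)
  open +-*-Solver using (solve; con; _:=_; _:+_; _:*_; _:-_; :-_)

  ⟦_⟧ : Bool → ℤ
  ⟦ true ⟧  = 1ℤ
  ⟦ false ⟧ = 0ℤ

  module Sum = SemiringSum +-*-semiring

  -- Opaque, as unification would otherwise unfold sums into folds.
  opaque

    sum : ∀ {n} → (Fin n → ℤ) → ℤ
    sum = Sum.sum

    sum-zero : ∀ (f : Fin 0 → ℤ) → sum f ≡ 0ℤ
    sum-zero f = refl

    sum-suc : ∀ {n} (f : Fin (suc n) → ℤ) → sum f ≡ f zero + sum (λ i → f (suc i))
    sum-suc f = refl

    sum-cong : ∀ {n} {f g : Fin n → ℤ} → (∀ i → f i ≡ g i) → sum f ≡ sum g
    sum-cong {n} = Sum.sum-cong-≗ {n}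

    sum-+ : ∀ {n} (f g : Fin n → ℤ) → sum (λ i → f i + g i) ≡ sum f + sum g
    sum-+ = Sum.∑-distrib-+

    sum-comm : ∀ {m n} (f : Fin m → Fin n → ℤ) → sum (λ i → sum (f i)) ≡ sum (λ j → sum (λ i → f i j))
    sum-comm = Sum.∑-comm

    sum-*ˡ : ∀ {n} c (f : Fin n → ℤ) → sum (λ i → c * f i) ≡ c * sum f
    sum-*ˡ c f = sym (Sum.*-distribˡ-sum c f)

    sum-*ʳ : ∀ {n} c (f : Fin n → ℤ) → sum (λ i → f i * c) ≡ sum f * c
    sum-*ʳ c f = sym (Sum.*-distribʳ-sum c f)

    sum-mono : ∀ {n} {f g : Fin n → ℤ} → (∀ i → f i ≤ g i) → sum f ≤ sum g
    sum-mono {zero}  f≤g = ≤-refl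
    sum-mono {suc n} f≤g = +-mono-≤ (f≤g zero) (sum-mono (λ i → f≤g (suc i)))

    sum-const : ∀ n c → sum {n} (λ _ → c) ≡ + n * c
    sum-const zero    c = sym (*-zeroˡ c)
    sum-const (suc n) c = trans (cong (λ z → c + z) (sum-const n c)) (sym (suc-* (+ n) c))

  sum-0 : ∀ n → sum {n} (λ _ → 0ℤ) ≡ 0ℤ
  sum-0 n = trans (sum-const n 0ℤ) (*-zeroʳ (+ n))

  sum-nonpos : ∀ {n} {f : Fin n → ℤ} → (∀ i → f i ≤ 0ℤ) → sum f ≤ 0ℤ
  sum-nonpos {n} {f} h = subst (sum f ≤_) (sum-0 n) (sum-mono h)

  sum-nonneg : ∀ {n} {f : Fin n → ℤ} → (∀ i → 0ℤ ≤ f i) → 0ℤ ≤ sum f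
  sum-nonneg {n} {f} h = subst (_≤ sum f) (sum-0 n) (sum-mono h)

  ∀-Bool? : {P : Bool → Set} → (∀ b → Dec (P b)) → Dec (∀ b → P b)
  ∀-Bool? {P} P? = map′ both (λ h → h true , h false) (P? true ×-dec P? false)
    where
    both : P true × P false → ∀ b → P b
    both (t , _) true  = t
    both (_ , f) false = f

  -- A function of the graphs on four labelled vertices x, y, u, v, taking
  -- the adjacency of xy, xu, xv, yu, yv and uv.
  Weight : Set
  Weight = Bool → Bool → Bool → Bool → Bool → Bool → ℤ

  infixl 6 _⊞_

  _⊞_ : Weight → Weight → Weight
  (Φ ⊞ Ψ) p q r s t w = Φ p q r s t w + Ψ p q r s t w

  _⊠_ : ℤ → Weight → Weight
  (c ⊠ Φ) p q r s t w = c * Φ p q r s t w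

  infixr 7 _⊠_

  -- The weights of the graphs with two consecutive vertices interchanged.
  swap₁₂ swap₂₃ swap₃₄ : Weight → Weight
  swap₁₂ Φ p q r s t w = Φ p s t q r w
  swap₂₃ Φ p q r s t w = Φ q p r s w t
  swap₃₄ Φ p q r s t w = Φ p r q t s w

  -- The sum over all 24 relabellings, by coset representatives along the
  -- chain of symmetric groups on x y, x y u and x y u v.
  symmetrise₂ symmetrise₃ symmetrise₄ symmetrise : Weight → Weight
  symmetrise₂ Φ = Φ ⊞ swap₁₂ Φ
  symmetrise₃ Φ = Φ ⊞ swap₂₃ Φ ⊞ swap₁₂ (swap₂₃ Φ)
  symmetrise₄ Φ = Φ ⊞ swap₃₄ Φ ⊞ swap₂₃ (swap₃₄ Φ) ⊞ swap₁₂ (swap₂₃ (swap₃₄ Φ))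
  symmetrise Φ = symmetrise₄ (symmetrise₃ (symmetrise₂ Φ))

  ∀-graph? : {P : Bool → Bool → Bool → Bool → Bool → Bool → Set} →
    (∀ p q r s t w → Dec (P p q r s t w)) → Dec (∀ p q r s t w → P p q r s t w)
  ∀-graph? P? = ∀-Bool? λ p → ∀-Bool? λ q → ∀-Bool? λ r → ∀-Bool? λ s → ∀-Bool? λ t → ∀-Bool? λ w → P? p q r s t w

  -- The weight of a vertex u relative to an edge xy, with q = xu and s = yu.
  h : Bool → Bool → ℤ
  h q s = + 3 * ⟦ q xor s ⟧ + + 2 * ⟦ q ∧ s ⟧

  -- The cuts are evaluated at uv: cut₁ is the cut around N(x), and cut₂ the
  -- one around N(x) ∩ N(y), counted when x and y are not adjacent.
  edge edge-h edge-hh edge-edge odd cut₁ cut₂ : Weight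
  edge      p q r s t w = ⟦ p ⟧
  edge-h    p q r s t w = ⟦ p ⟧ * h q s
  edge-hh   p q r s t w = ⟦ p ⟧ * (h q s * h r t)
  edge-edge p q r s t w = ⟦ p ⟧ * ⟦ w ⟧
  odd       p q r s t w = ⟦ p xor (q xor s) ⟧
  cut₁      p q r s t w = ⟦ q xor r ⟧ * (+ 2 * ⟦ w ⟧ - 1ℤ)
  cut₂      p q r s t w = (1ℤ - ⟦ p ⟧) * (⟦ (q ∧ s) xor (r ∧ t) ⟧ * (+ 2 * ⟦ w ⟧ - 1ℤ))

  -- Here `-[1+ 2 ]` is -3 and `-[1+ 8 ]` is -9. If C₁ and C₂ are the totals of `cut₁` and `cut₂`,
  -- the totals of these three weights are 2K₂ - 3NK - 9e² - 9C₂, N²e - NT - C₁ and NT - 3N²e + NK.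
  edge-hh-bound odd-bound odd-count : Weight
  edge-hh-bound = + 2 ⊠ edge-hh ⊞ -[1+ 2 ] ⊠ edge-h ⊞ -[1+ 8 ] ⊠ edge-edge ⊞ -[1+ 8 ] ⊠ cut₂
  odd-bound = edge ⊞ -1ℤ ⊠ odd ⊞ -1ℤ ⊠ cut₁
  odd-count = odd ⊞ -[1+ 2 ] ⊠ edge ⊞ edge-h

  -- A finite check over the 64 values of the six adjacencies. Tuples with repeated vertices yield
  -- some of these values too, so they are covered as well.
  edge-hh-bound≤0 : ∀ p q r s t w → symmetrise edge-hh-bound p q r s t w ≤ 0ℤ
  edge-hh-bound≤0 = toWitness {a? = ∀-graph? λ p q r s t w → symmetrise edge-hh-bound p q r s t w ≤? 0ℤ} _

  -- Each term depends on at most three vertices. Over the six orders of a triple with one, two or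
  -- three edges, `edge` sums to 2, 4, 6, `odd` to 6, 0, 6 and `cut₁` to -4, 4, 0, so the terms
  -- balance.
  odd-bound≤0 : ∀ p q r s t w → symmetrise odd-bound p q r s t w ≤ 0ℤ
  odd-bound≤0 = toWitness {a? = ∀-graph? λ p q r s t w → symmetrise odd-bound p q r s t w ≤? 0ℤ} _

  -- Over the six orders of a triple with one, two or three edges, `odd` sums to 6, 0, 6, three
  -- times `edge` to 6, 12, 18 and `edge-h` to 0, 12, 12. This is what the coefficients 3 and 2 in
  -- `h` are for.
  odd-count≡0 : ∀ p q r s t w → symmetrise odd-count p q r s t w ≡ 0ℤ
  odd-count≡0 = toWitness {a? = ∀-graph? λ p q r s t w → symmetrise odd-count p q r s t w ≟ 0ℤ} _

  square : ∀ i → 0ℤ ≤ i * i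
  square (+ i)    = subst (0ℤ ≤_) (pos-* i i) (+≤+ ℕ.z≤n)
  square -[1+ i ] = +≤+ ℕ.z≤n

  j≤0⇒i≤i-j : ∀ {i j} → j ≤ 0ℤ → i ≤ i - j
  j≤0⇒i≤i-j {i} {j} j≤0 = subst (_≤ i - j) (+-identityʳ i) (+-monoʳ-≤ i (neg-mono-≤ j≤0))

  -- Totals of weights over the vertex quadruples of a graph.

  module Graph {n} (a : Fin n → Fin n → Bool) (a-sym : ∀ x y → a x y ≡ a y x) where

    sum₂ : (Fin n → Fin n → ℤ) → ℤ
    sum₂ f = sum λ x → sum (f x)

    sum₂-cong : ∀ {f g : Fin n → Fin n → ℤ} → (∀ x y → f x y ≡ g x y) → sum₂ f ≡ sum₂ g
    sum₂-cong f≗g = sum-cong λ x → sum-cong (f≗g x)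

    sum₂-+ : ∀ (f g : Fin n → Fin n → ℤ) → sum₂ (λ x y → f x y + g x y) ≡ sum₂ f + sum₂ g
    sum₂-+ f g = trans (sum-cong λ x → sum-+ (f x) (g x)) (sum-+ (λ x → sum (f x)) (λ x → sum (g x)))

    sum₂-* : ∀ c (f : Fin n → Fin n → ℤ) → sum₂ (λ x y → c * f x y) ≡ c * sum₂ f
    sum₂-* c f = trans (sum-cong λ x → sum-*ˡ c (f x)) (sum-*ˡ c _)

    total : Weight → ℤ
    total Φ = sum₂ λ x y → sum₂ λ u v → Φ (a x y) (a x u) (a x v) (a y u) (a y v) (a u v)

    total-⊞ : ∀ Φ Ψ → total (Φ ⊞ Ψ) ≡ total Φ + total Ψ
    total-⊞ Φ Ψ = trans (sum₂-cong λ x y → sum₂-+ _ _) (sum₂-+ _ _)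

    total-⊠ : ∀ c Φ → total (c ⊠ Φ) ≡ c * total Φ
    total-⊠ c Φ = trans (sum₂-cong λ x y → sum₂-* c _) (sum₂-* c _)

    -- Exchanging the order of two summations permutes the six adjacencies. Only that of the
    -- exchanged pair gets its arguments reversed, which `a-sym` undoes.
    total-swap₁₂ : ∀ Φ → total (swap₁₂ Φ) ≡ total Φ
    total-swap₁₂ Φ = trans (sum-comm _) (sum₂-cong λ x y → sum₂-cong λ u v →
      cong (λ p → Φ p (a x u) (a x v) (a y u) (a y v) (a u v)) (a-sym y x))

    total-swap₂₃ : ∀ Φ → total (swap₂₃ Φ) ≡ total Φ
    total-swap₂₃ Φ = sum-cong λ x → trans (sum-comm _) (sum₂-cong λ y u → sum-cong λ v →
      cong (λ s → Φ (a x y) (a x u) (a x v) s (a y v) (a u v)) (a-sym u y))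

    total-swap₃₄ : ∀ Φ → total (swap₃₄ Φ) ≡ total Φ
    total-swap₃₄ Φ = sum₂-cong λ x y → trans (sum-comm _) (sum₂-cong λ u v →
      cong (Φ (a x y) (a x u) (a x v) (a y u) (a y v)) (a-sym v u))

    private
      sum-of-equals : ∀ {i j k} → j ≡ i → k ≡ i → i + j + k ≡ + 3 * i
      sum-of-equals {i} refl refl = solve 1 (λ i → i :+ i :+ i := con (+ 3) :* i) refl i

    total-symmetrise : ∀ Φ → total (symmetrise Φ) ≡ + 24 * total Φ
    total-symmetrise Φ = begin
      total (symmetrise₄ Φ₃)   ≡⟨ total₄ Φ₃ ⟩
      + 4 * total Φ₃           ≡⟨ cong (+ 4 *_) (total₃ Φ₂) ⟩
      + 4 * (+ 3 * total Φ₂)   ≡⟨ cong (λ i → + 4 * (+ 3 * i)) (total₂ Φ) ⟩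
      + 4 * (+ 3 * (+ 2 * total Φ)) ≡⟨ solve 1 (λ i → con (+ 4) :* (con (+ 3) :* (con (+ 2) :* i)) := con (+ 24) :* i) refl (total Φ) ⟩
      + 24 * total Φ           ∎
      where
      open ≡-Reasoning
      Φ₂ = symmetrise₂ Φ
      Φ₃ = symmetrise₃ Φ₂
      total₂ : ∀ Ψ → total (symmetrise₂ Ψ) ≡ + 2 * total Ψ
      total₂ Ψ = trans (trans (total-⊞ Ψ (swap₁₂ Ψ)) (cong (λ i → total Ψ + i) (total-swap₁₂ Ψ)))
        (solve 1 (λ i → i :+ i := con (+ 2) :* i) refl (total Ψ))
      total₃ : ∀ Ψ → total (symmetrise₃ Ψ) ≡ + 3 * total Ψ
      total₃ Ψ = trans
        (trans (total-⊞ (Ψ ⊞ swap₂₃ Ψ) (swap₁₂ (swap₂₃ Ψ))) (cong (λ i → i + total (swap₁₂ (swap₂₃ Ψ))) (total-⊞ Ψ (swap₂₃ Ψ))))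
        (sum-of-equals (total-swap₂₃ Ψ) (trans (total-swap₁₂ (swap₂₃ Ψ)) (total-swap₂₃ Ψ)))
      total₄ : ∀ Ψ → total (symmetrise₄ Ψ) ≡ + 4 * total Ψ
      total₄ Ψ = trans (total-⊞ (Ψ ⊞ Ψ₁ ⊞ Ψ₂) Ψ₃) (trans (cong₂ _+_
        (trans (trans (total-⊞ (Ψ ⊞ Ψ₁) Ψ₂) (cong (λ i → i + total Ψ₂) (total-⊞ Ψ Ψ₁))) (sum-of-equals e₁ e₂)) e₃)
        (solve 1 (λ i → con (+ 3) :* i :+ i := con (+ 4) :* i) refl (total Ψ)))
        where
        Ψ₁ = swap₃₄ Ψ
        Ψ₂ = swap₂₃ Ψ₁
        Ψ₃ = swap₁₂ Ψ₂
        e₁ = total-swap₃₄ Ψ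
        e₂ = trans (total-swap₂₃ Ψ₁) e₁
        e₃ = trans (total-swap₁₂ Ψ₂) e₂

    -- The total is blind to relabelling, so a pointwise bound is required only of the symmetrised
    -- weight, whose total is 24 times as large.
    total-nonpos : ∀ Φ → (∀ p q r s t w → symmetrise Φ p q r s t w ≤ 0ℤ) → total Φ ≤ 0ℤ
    total-nonpos Φ Φ≤0 = *-cancelˡ-≤-pos (total Φ) 0ℤ (+ 24) (subst (_≤ 0ℤ) (total-symmetrise Φ)
      (sum-nonpos λ x → sum-nonpos λ y → sum-nonpos λ u → sum-nonpos λ v → Φ≤0 (a x y) (a x u) (a x v) (a y u) (a y v) (a u v)))

    total-zero : ∀ Φ → (∀ p q r s t w → symmetrise Φ p q r s t w ≡ 0ℤ) → total Φ ≡ 0ℤ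
    total-zero Φ Φ≡0 = *-cancelˡ-≡ (+ 24) (total Φ) 0ℤ (trans (sym (total-symmetrise Φ))
      (trans (sum₂-cong λ x y → trans (sum₂-cong λ u v → Φ≡0 (a x y) (a x u) (a x v) (a y u) (a y v) (a u v)) sum₂-0) sum₂-0))
      where
      sum₂-0 : sum₂ (λ _ _ → 0ℤ) ≡ 0ℤ
      sum₂-0 = trans (sum-cong λ x → sum-0 n) (sum-0 n)

    -- As in the header, with N the number of vertices.
    N e T K K₂ : ℤ
    N = + n
    e = sum₂ λ x y → ⟦ a x y ⟧
    T = sum₂ λ x y → sum λ u → ⟦ a x y xor (a x u xor a y u) ⟧

    X : Fin n → Fin n → ℤ
    X x y = sum λ u → h (a x u) (a y u)

    K  = sum₂ λ x y → ⟦ a x y ⟧ * X x y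
    K₂ = sum₂ λ x y → ⟦ a x y ⟧ * (X x y * X x y)

    -- A vertex on which the weight does not depend contributes a factor `N`: two of them here, one
    -- for `odd` and `edge-h`.
    total-edge : total edge ≡ N * (N * e)
    total-edge = trans (sum₂-cong λ x y → trans (sum-cong λ u → sum-const n _) (sum-const n _))
      (trans (sum₂-* N _) (cong (N *_) (sum₂-* N _)))

    total-odd : total odd ≡ N * T
    total-odd = trans (sum₂-cong λ x y → trans (sum-cong λ u → sum-const n _) (sum-*ˡ N _)) (sum₂-* N _)

    total-edge-h : total edge-h ≡ N * K
    total-edge-h = trans (sum₂-cong λ x y → trans (sum-cong λ u → sum-const n _)
      (trans (sum-*ˡ N _) (cong (N *_) (sum-*ˡ ⟦ a x y ⟧ _)))) (sum₂-* N _)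

    total-edge-edge : total edge-edge ≡ e * e
    total-edge-edge = trans (sum₂-cong λ x y → trans (sum₂-* ⟦ a x y ⟧ _) (*-comm ⟦ a x y ⟧ e)) (sum₂-* e _)

    -- For fixed x and y the factors in u and v separate, and each sums to `X x y`.
    total-edge-hh : total edge-hh ≡ K₂
    total-edge-hh = sum₂-cong λ x y → trans (sum₂-* ⟦ a x y ⟧ _) (cong (⟦ a x y ⟧ *_)
      (trans (sum-cong λ u → sum-*ˡ (h (a x u) (a y u)) _) (sum-*ʳ (X x y) _)))

    -- Expands the nonnegative sum of `⟦ a x y ⟧` times the square of `e * X x y - K`. The common
    -- factor `e` stays until positivity of `e` is at hand, which avoids a case `e ≡ 0ℤ`.
    cauchy-schwarz : e * (K * K) ≤ e * (e * K₂)
    cauchy-schwarz = i-j≤0⇒i≤j (subst (_≤ 0ℤ) eq (neg-mono-≤ nonneg))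
      where
      f : Fin n → Fin n → ℤ
      f x y = ⟦ a x y ⟧ * ((e * X x y - K) * (e * X x y - K))
      nonneg : 0ℤ ≤ sum₂ f
      nonneg = sum-nonneg λ x → sum-nonneg λ y → bit (a x y) (square (e * X x y - K))
        where
        bit : ∀ b {i} → 0ℤ ≤ i → 0ℤ ≤ ⟦ b ⟧ * i
        bit true  {i} 0≤i = subst (0ℤ ≤_) (sym (*-identityˡ i)) 0≤i
        bit false {i} 0≤i = ≤-reflexive (sym (*-zeroˡ i))
      expand : sum₂ f ≡ (e * e) * K₂ + ((- (+ 2 * e * K)) * K + (K * K) * e)
      expand = trans (sum₂-cong λ x y → solve 4 (λ b e X K →
          b :* ((e :* X :- K) :* (e :* X :- K)) :=
          (e :* e) :* (b :* (X :* X)) :+ ((:- (con (+ 2) :* e :* K)) :* (b :* X) :+ (K :* K) :* b))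
          refl ⟦ a x y ⟧ e (X x y) K)
        (trans (sum₂-+ _ _) (cong₂ _+_ (sum₂-* (e * e) _)
          (trans (sum₂-+ _ _) (cong₂ _+_ (sum₂-* (- (+ 2 * e * K)) _) (sum₂-* (K * K) _)))))
      eq : - sum₂ f ≡ e * (K * K) - e * (e * K₂)
      eq = trans (cong -_ expand) (solve 3 (λ e K K₂ →
        :- ((e :* e) :* K₂ :+ ((:- (con (+ 2) :* e :* K)) :* K :+ (K :* K) :* e)) :=
        e :* (K :* K) :- e :* (e :* K₂)) refl e K K₂)

    -- Graphs in which no cut has more edges than non-edges.

    module _ (no-cut : ∀ (s : Fin n → Bool) → sum₂ (λ x y → ⟦ s x xor s y ⟧ * (+ 2 * ⟦ a x y ⟧ - 1ℤ)) ≤ 0ℤ) where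

      total-cut₁≤0 : total cut₁ ≤ 0ℤ
      total-cut₁≤0 = sum-nonpos λ x → sum-nonpos λ y → no-cut (a x)

      -- For fixed x and y the sum over u and v is 0 if they are adjacent, and otherwise the
      -- hypothesis for the cut around their common neighbourhood.
      total-cut₂≤0 : total cut₂ ≤ 0ℤ
      total-cut₂≤0 = sum-nonpos λ x → sum-nonpos λ y →
        subst (_≤ 0ℤ) (sym (sum₂-* (1ℤ - ⟦ a x y ⟧) _)) (bit (a x y) (no-cut (λ u → a x u ∧ a y u)))
        where
        bit : ∀ b {i} → i ≤ 0ℤ → (1ℤ - ⟦ b ⟧) * i ≤ 0ℤ
        bit true  {i} i≤0 = ≤-reflexive (*-zeroˡ i)
        bit false {i} i≤0 = subst (_≤ 0ℤ) (sym (*-identityˡ i)) i≤0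

      -- The total of `odd-bound` gives N²e - NT ≤ C with C ≤ 0; one factor `N` then cancels.
      Ne≤T : .{{_ : ℕ.NonZero n}} → N * e ≤ T
      Ne≤T = *-cancelˡ-≤-pos (N * e) T N {{N-pos}} (0≤i-j⇒j≤i (begin
        0ℤ                                                 ≤⟨ neg-mono-≤ total-cut₁≤0 ⟩
        - C                                                ≤⟨ j≤0⇒i≤i-j (total-nonpos odd-bound odd-bound≤0) ⟩
        - C - total odd-bound                              ≡⟨ cong (λ z → - C - z) expand ⟩
        - C - (N * (N * e) + -1ℤ * (N * T) + -1ℤ * C)
          ≡⟨ solve 3 (λ c i j → :- c :- (i :+ con -1ℤ :* j :+ con -1ℤ :* c) := j :- i) refl C (N * (N * e)) (N * T) ⟩
        N * T - N * (N * e)                                ∎))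
        where
        open ≤-Reasoning
        N-pos : Positive N
        N-pos = positive (+<+ (ℕ.>-nonZero⁻¹ n))
        C = total cut₁
        expand : total odd-bound ≡ N * (N * e) + -1ℤ * (N * T) + -1ℤ * C
        expand = trans (total-⊞ (edge ⊞ -1ℤ ⊠ odd) (-1ℤ ⊠ cut₁)) (cong₂ _+_
          (trans (total-⊞ edge (-1ℤ ⊠ odd)) (cong₂ _+_ total-edge (trans (total-⊠ -1ℤ odd) (cong (-1ℤ *_) total-odd))))
          (total-⊠ -1ℤ cut₁))

      K≡3Ne-T : .{{_ : ℕ.NonZero n}} → K ≡ + 3 * (N * e) - T
      K≡3Ne-T = *-cancelˡ-≡ N K _ {{ℕ.>-nonZero (ℕ.>-nonZero⁻¹ n)}} (i-j≡0⇒i≡j _ _ (begin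
        N * K - N * (+ 3 * (N * e) - T)  ≡⟨ solve 4 (λ n e t k → n :* k :- n :* (con (+ 3) :* (n :* e) :- t) :=
                                             n :* t :+ con -[1+ 2 ] :* (n :* (n :* e)) :+ n :* k) refl N e T K ⟩
        N * T + -[1+ 2 ] * (N * (N * e)) + N * K ≡⟨ sym expand ⟩
        total odd-count                  ≡⟨ total-zero odd-count odd-count≡0 ⟩
        0ℤ                               ∎))
        where
        open ≡-Reasoning
        expand : total odd-count ≡ N * T + -[1+ 2 ] * (N * (N * e)) + N * K
        expand = trans (total-⊞ (odd ⊞ -[1+ 2 ] ⊠ edge) edge-h) (cong₂ _+_
          (trans (total-⊞ odd (-[1+ 2 ] ⊠ edge)) (cong₂ _+_ total-odd (trans (total-⊠ -[1+ 2 ] edge) (cong (-[1+ 2 ] *_) total-edge))))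
          total-edge-h)

      2K₂≤ : + 2 * K₂ ≤ + 3 * (N * K) + + 9 * (e * e)
      2K₂≤ = 0≤i-j⇒j≤i (begin
        0ℤ                              ≡⟨⟩
        - (+ 9 * 0ℤ)                    ≤⟨ neg-mono-≤ (*-monoˡ-≤-nonNeg (+ 9) total-cut₂≤0) ⟩
        - (+ 9 * C)                     ≤⟨ j≤0⇒i≤i-j (total-nonpos edge-hh-bound edge-hh-bound≤0) ⟩
        - (+ 9 * C) - total edge-hh-bound ≡⟨ cong (λ z → - (+ 9 * C) - z) expand ⟩
        - (+ 9 * C) - (+ 2 * K₂ + -[1+ 2 ] * (N * K) + -[1+ 8 ] * (e * e) + -[1+ 8 ] * C)
          ≡⟨ solve 4 (λ c i j k → :- (con (+ 9) :* c) :- (con (+ 2) :* i :+ con -[1+ 2 ] :* j :+ con -[1+ 8 ] :* k :+ con -[1+ 8 ] :* c)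
                      := con (+ 3) :* j :+ con (+ 9) :* k :- con (+ 2) :* i) refl C K₂ (N * K) (e * e) ⟩
        + 3 * (N * K) + + 9 * (e * e) - + 2 * K₂ ∎)
        where
        open ≤-Reasoning
        C = total cut₂
        expand : total edge-hh-bound ≡ + 2 * K₂ + -[1+ 2 ] * (N * K) + -[1+ 8 ] * (e * e) + -[1+ 8 ] * C
        expand = trans (total-⊞ (+ 2 ⊠ edge-hh ⊞ -[1+ 2 ] ⊠ edge-h ⊞ -[1+ 8 ] ⊠ edge-edge) (-[1+ 8 ] ⊠ cut₂)) (cong₂ _+_
          (trans (total-⊞ (+ 2 ⊠ edge-hh ⊞ -[1+ 2 ] ⊠ edge-h) (-[1+ 8 ] ⊠ edge-edge)) (cong₂ _+_
            (trans (total-⊞ (+ 2 ⊠ edge-hh) (-[1+ 2 ] ⊠ edge-h)) (cong₂ _+_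
              (trans (total-⊠ (+ 2) edge-hh) (cong (+ 2 *_) total-edge-hh))
              (trans (total-⊠ -[1+ 2 ] edge-h) (cong (-[1+ 2 ] *_) total-edge-h))))
            (trans (total-⊠ -[1+ 8 ] edge-edge) (cong (-[1+ 8 ] *_) total-edge-edge))))
          (total-⊠ -[1+ 8 ] cut₂))

      -- As K = 3Ne - T, the second factor is 2K - 3Ne and the product is 2K² - 3NeK. Cauchy-Schwarz
      -- replaces K² by eK₂, and in the bound for 2K₂ the term 3NK cancels the subtracted 3NeK.
      [3Ne-T][3Ne-2T]≤9e³ : .{{_ : ℕ.NonZero n}} → e * ((+ 3 * (N * e) - T) * (+ 3 * (N * e) - + 2 * T)) ≤ e * (+ 9 * (e * (e * e)))
      [3Ne-T][3Ne-2T]≤9e³ = begin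
        e * ((+ 3 * (N * e) - T) * (+ 3 * (N * e) - + 2 * T))
          ≡⟨ solve 3 (λ e ne t → e :* ((con (+ 3) :* ne :- t) :* (con (+ 3) :* ne :- con (+ 2) :* t)) :=
               con (+ 2) :* (e :* ((con (+ 3) :* ne :- t) :* (con (+ 3) :* ne :- t))) :- con (+ 3) :* (e :* ne :* (con (+ 3) :* ne :- t))) refl e (N * e) T ⟩
        + 2 * (e * ((+ 3 * (N * e) - T) * (+ 3 * (N * e) - T))) - + 3 * (e * (N * e) * (+ 3 * (N * e) - T))
          ≡⟨ cong (λ k → + 2 * (e * (k * k)) - + 3 * (e * (N * e) * k)) (sym K≡3Ne-T) ⟩
        + 2 * (e * (K * K)) - + 3 * (e * (N * e) * K)
          ≤⟨ +-monoˡ-≤ _ (*-monoˡ-≤-nonNeg (+ 2) cauchy-schwarz) ⟩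
        + 2 * (e * (e * K₂)) - + 3 * (e * (N * e) * K)
          ≡⟨ cong (_- + 3 * (e * (N * e) * K)) (solve 2 (λ e k → con (+ 2) :* (e :* (e :* k)) := e :* e :* (con (+ 2) :* k)) refl e K₂) ⟩
        e * e * (+ 2 * K₂) - + 3 * (e * (N * e) * K)
          ≤⟨ +-monoˡ-≤ _ (*-monoˡ-≤-nonNeg (e * e) {{nonNegative 0≤e²}} 2K₂≤) ⟩
        e * e * (+ 3 * (N * K) + + 9 * (e * e)) - + 3 * (e * (N * e) * K)
          ≡⟨ solve 3 (λ e n k → e :* e :* (con (+ 3) :* (n :* k) :+ con (+ 9) :* (e :* e)) :- con (+ 3) :* (e :* (n :* e) :* k)
               := e :* (con (+ 9) :* (e :* (e :* e)))) refl e N K ⟩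
        e * (+ 9 * (e * (e * e))) ∎
        where
        open ≤-Reasoning
        0≤e² : 0ℤ ≤ e * e
        0≤e² = square e

-- From systems of subsets to adjacency matrices.

module PairSystems where
  open import Data.Bool.Base using (Bool; true; false; T; _∧_; _∨_; _xor_; if_then_else_)
  import Data.Bool.Properties as 𝔹ₚ
  open import Data.Fin.Base using (Fin; zero; suc)
  open import Data.Fin.Properties using (_≟_)
  open import Data.Fin.Subset using (Subset; inside; outside; ⊥; ⁅_⁆; _∪_; ∣_∣)
  open import Data.Fin.Subset.Properties using (_⊆?_; ∪-identityˡ; ∪-identityʳ; ∪-comm; ∪-idem; ∣⊥∣≡0; ∣⁅x⁆∣≡1)
  open import Data.Integer.Base hiding (suc; ∣_∣)
  open import Data.Integer.Properties hiding (_≟_)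
  open import Data.Integer.Solver using (module +-*-Solver)
  open import Data.List.Base using ([]; _∷_; _++_; map; filter; length)
  open import Data.List.Properties using (filter-++; length-++)
  open import Data.Nat.Base as ℕ using (ℕ; zero; suc; parity)
  import Data.Nat.Properties as ℕₚ
  open import Data.Parity.Base using (Parity; 0ℙ; 1ℙ)
  import Data.Parity.Properties as ℙₚ
  open import Data.Vec.Base using ([]; _∷_; lookup)
  open import Data.Vec.Properties using (lookup-zipWith; lookup-replicate)
  open import Function.Base using (_∘_)
  open import Relation.Nullary using (Dec; yes; no; does; contradiction)
  open import Relation.Nullary.Decidable using (T?; _×-dec_; isYes≗does; dec-true; dec-false)
  open +-*-Solver using (solve; con; _:=_; _:+_; _:*_; _:-_; :-_)
  open GraphInequality

  -- The recursion is that of `subsets`, so that filtered lists turn into sums and sums over sets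
  -- can be compared with sums over vertices by induction on `n`.
  sumₛ : ∀ {n} → (Subset n → ℤ) → ℤ
  sumₛ {zero}  g = g []
  sumₛ {suc n} g = sumₛ (λ S → g (inside ∷ S)) + sumₛ (λ S → g (outside ∷ S))

  length-filter-map : ∀ {A B : Set} {P : B → Set} (P? : ∀ y → Dec (P y)) (f : A → B) xs →
    length (filter P? (map f xs)) ≡ length (filter (λ x → P? (f x)) xs)
  length-filter-map P? f []       = refl
  length-filter-map P? f (x ∷ xs) with does (P? (f x))
  ... | true  = cong suc (length-filter-map P? f xs)
  ... | false = length-filter-map P? f xs

  count-subsets : ∀ {n} {P : Subset n → Set} (P? : ∀ S → Dec (P S)) →
    + length (filter P? (subsets n)) ≡ sumₛ (λ S → ⟦ does (P? S) ⟧)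
  count-subsets {zero} P? with does (P? [])
  ... | true  = refl
  ... | false = refl
  count-subsets {suc n} P? = begin
    + length (filter P? (ins ++ outs))                      ≡⟨ cong (+_ ∘ length) (filter-++ P? ins outs) ⟩
    + length (filter P? ins ++ filter P? outs)              ≡⟨ cong +_ (length-++ (filter P? ins)) ⟩
    + length (filter P? ins) + + length (filter P? outs)
      ≡⟨ cong₂ (λ i j → + i + + j) (length-filter-map P? (inside ∷_) (subsets n)) (length-filter-map P? (outside ∷_) (subsets n)) ⟩
    + length (filter (λ S → P? (inside ∷ S)) (subsets n)) + + length (filter (λ S → P? (outside ∷ S)) (subsets n))
      ≡⟨ cong₂ _+_ (count-subsets (λ S → P? (inside ∷ S))) (count-subsets (λ S → P? (outside ∷ S))) ⟩
    sumₛ (λ S → ⟦ does (P? S) ⟧)                            ∎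
    where
    open ≡-Reasoning
    ins  = map (inside ∷_) (subsets n)
    outs = map (outside ∷_) (subsets n)

  Supported : ∀ {n} → ℕ → (Subset n → ℤ) → Set
  Supported k g = ∀ S → ∣ S ∣ ≢ k → g S ≡ 0ℤ

  module _ {n k : ℕ} {g : Subset (suc n) → ℤ} where

    supported-inside : Supported (suc k) g → Supported k (λ S → g (inside ∷ S))
    supported-inside h S S≢k = h (inside ∷ S) (λ e → S≢k (ℕₚ.suc-injective e))

    supported-outside : Supported k g → Supported k (λ S → g (outside ∷ S))
    supported-outside h S S≢k = h (outside ∷ S) S≢k

  sumₛ-0 : ∀ {n} (g : Subset n → ℤ) → (∀ S → g S ≡ 0ℤ) → sumₛ g ≡ 0ℤ
  sumₛ-0 {zero}  g h = h []
  sumₛ-0 {suc n} g h = cong₂ _+_ (sumₛ-0 _ (λ S → h (inside ∷ S))) (sumₛ-0 _ (λ S → h (outside ∷ S)))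

  sumₛ-⊥ : ∀ {n} {g : Subset n → ℤ} → Supported 0 g → sumₛ g ≡ g ⊥
  sumₛ-⊥ {zero}  h = refl
  sumₛ-⊥ {suc n} h = trans (cong₂ _+_ (sumₛ-0 _ (λ S → h (inside ∷ S) (λ ()))) (sumₛ-⊥ (supported-outside h))) (+-identityˡ _)

  sum-singletons : ∀ {n} {g : Subset n → ℤ} → Supported 1 g → sum (λ x → g ⁅ x ⁆) ≡ sumₛ g
  sum-singletons {zero}  h = trans (sum-zero _) (sym (h [] (λ ())))
  sum-singletons {suc n} h = trans (sum-suc _)
    (cong₂ _+_ (sym (sumₛ-⊥ (supported-inside h))) (sum-singletons (supported-outside h)))

  -- Two ordered tuples give each pair, and tuples with x = y give singletons, where `g` vanishes.
  -- In the induction the pairs through `zero` correspond to singletons of the remaining vertices,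
  -- once for each position of `zero`.
  sum-pairs : ∀ {n} {g : Subset n → ℤ} → Supported 2 g →
    sum (λ x → sum λ y → g (⁅ x ⁆ ∪ ⁅ y ⁆)) ≡ + 2 * sumₛ g
  sum-pairs {zero}  {g} h = trans (sum-zero _) (cong (+ 2 *_) (sym (h [] (λ ()))))
  sum-pairs {suc n} {g} h = begin
    sum (λ x → sum λ y → g (⁅ x ⁆ ∪ ⁅ y ⁆))
      ≡⟨ sum-suc _ ⟩
    sum (λ y → g (⁅ zero ⁆ ∪ ⁅ y ⁆)) + sum (λ x → sum λ y → g (⁅ suc x ⁆ ∪ ⁅ y ⁆))
      ≡⟨ cong₂ _+_ (sum-suc _) (trans (sum-cong λ x → sum-suc _) (sum-+ _ _)) ⟩
    (g (inside ∷ (⊥ ∪ ⊥)) + sum (λ y → g (inside ∷ (⊥ ∪ ⁅ y ⁆)))) +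
    (sum (λ x → g (inside ∷ (⁅ x ⁆ ∪ ⊥))) + sum (λ x → sum λ y → g (outside ∷ (⁅ x ⁆ ∪ ⁅ y ⁆))))
      ≡⟨ cong₂ _+_
           (cong₂ _+_ zero-zero (trans (sum-cong λ y → cong (λ S → g (inside ∷ S)) (∪-identityˡ ⁅ y ⁆)) in-sum))
           (cong₂ _+_ (trans (sum-cong λ x → cong (λ S → g (inside ∷ S)) (∪-identityʳ ⁅ x ⁆)) in-sum) (sum-pairs (supported-outside h))) ⟩
    (0ℤ + I) + (I + + 2 * O)
      ≡⟨ solve 2 (λ i o → (con 0ℤ :+ i) :+ (i :+ con (+ 2) :* o) := con (+ 2) :* (i :+ o)) refl I O ⟩
    + 2 * (I + O) ∎
    where
    open ≡-Reasoning
    I = sumₛ (λ S → g (inside ∷ S))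
    O = sumₛ (λ S → g (outside ∷ S))
    in-sum : sum (λ x → g (inside ∷ ⁅ x ⁆)) ≡ I
    in-sum = sum-singletons (supported-inside h)
    zero-zero : g (inside ∷ (⊥ ∪ ⊥)) ≡ 0ℤ
    zero-zero = h _ λ e → contradiction (trans (sym e) (cong suc (trans (cong ∣_∣ (∪-identityˡ (⊥ {n}))) (∣⊥∣≡0 n)))) (λ ())

  -- The sum splits into eight blocks according to which of x, y, u are `zero`. The three blocks
  -- with a single `zero` are sums over pairs, the block without `zero` is the induction hypothesis,
  -- and the other four see only sets that are too small.
  sum-triples : ∀ {n} {g : Subset n → ℤ} → Supported 3 g →
    sum (λ x → sum λ y → sum λ u → g (⁅ x ⁆ ∪ (⁅ y ⁆ ∪ ⁅ u ⁆))) ≡ + 6 * sumₛ g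
  sum-triples {zero}  {g} h = trans (sum-zero _) (cong (+ 6 *_) (sym (h [] (λ ()))))
  sum-triples {suc n} {g} h = begin
    sum (λ x → sum λ y → sum λ u → g (⁅ x ⁆ ∪ (⁅ y ⁆ ∪ ⁅ u ⁆)))
      ≡⟨ sum-suc _ ⟩
    sum (λ y → sum λ u → g (⁅ zero ⁆ ∪ (⁅ y ⁆ ∪ ⁅ u ⁆))) + sum (λ x → sum λ y → sum λ u → g (⁅ suc x ⁆ ∪ (⁅ y ⁆ ∪ ⁅ u ⁆)))
      ≡⟨ cong₂ _+_ (expand zero) (trans (sum-cong λ x → expand (suc x))
           (trans (sum-+ _ _) (cong₂ _+_ (sum-+ _ _) (sum-+ _ _)))) ⟩
    ((g (inside ∷ (⊥ ∪ (⊥ ∪ ⊥))) + sum (λ u → g (inside ∷ (⊥ ∪ (⊥ ∪ ⁅ u ⁆))))) +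
      (sum (λ y → g (inside ∷ (⊥ ∪ (⁅ y ⁆ ∪ ⊥)))) + sum (λ y → sum λ u → g (inside ∷ (⊥ ∪ (⁅ y ⁆ ∪ ⁅ u ⁆)))))) +
    ((sum (λ x → g (inside ∷ (⁅ x ⁆ ∪ (⊥ ∪ ⊥)))) + sum (λ x → sum λ u → g (inside ∷ (⁅ x ⁆ ∪ (⊥ ∪ ⁅ u ⁆))))) +
      (sum (λ x → sum (λ y → g (inside ∷ (⁅ x ⁆ ∪ (⁅ y ⁆ ∪ ⊥))))) + sum (λ x → sum λ y → sum λ u → g (outside ∷ (⁅ x ⁆ ∪ (⁅ y ⁆ ∪ ⁅ u ⁆))))))
      ≡⟨ cong₂ _+_
           (cong₂ _+_
             (cong₂ _+_ (vanish (trans (cong (⊥ ∪_) (∪-identityˡ ⊥)) (∪-identityˡ ⊥)) (λ e → contradiction (trans (sym (∣⊥∣≡0 n)) e) (λ ())))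
               (vanish-sum λ u → trans (∪-identityˡ _) (∪-identityˡ _)))
             (cong₂ _+_ (vanish-sum λ y → trans (∪-identityˡ _) (∪-identityʳ _))
               (trans (sum-cong λ y → sum-cong λ u → cong (λ S → g (inside ∷ S)) (∪-identityˡ _)) in-sum)))
           (cong₂ _+_
             (cong₂ _+_ (vanish-sum λ x → trans (cong (⁅ x ⁆ ∪_) (∪-identityˡ ⊥)) (∪-identityʳ _))
               (trans (sum-cong λ x → sum-cong λ u → cong (λ S → g (inside ∷ (⁅ x ⁆ ∪ S))) (∪-identityˡ _)) in-sum))
             (cong₂ _+_ (trans (sum-cong λ x → sum-cong λ y → cong (λ S → g (inside ∷ (⁅ x ⁆ ∪ S))) (∪-identityʳ _)) in-sum)
               (sum-triples (supported-outside h)))) ⟩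
    ((0ℤ + 0ℤ) + (0ℤ + + 2 * I)) + ((0ℤ + + 2 * I) + (+ 2 * I + + 6 * O))
      ≡⟨ solve 2 (λ i o → ((con 0ℤ :+ con 0ℤ) :+ (con 0ℤ :+ con (+ 2) :* i)) :+ ((con 0ℤ :+ con (+ 2) :* i) :+ (con (+ 2) :* i :+ con (+ 6) :* o))
           := con (+ 6) :* (i :+ o)) refl I O ⟩
    + 6 * (I + O) ∎
    where
    open ≡-Reasoning
    I = sumₛ (λ S → g (inside ∷ S))
    O = sumₛ (λ S → g (outside ∷ S))
    in-sum : sum (λ x → sum λ y → g (inside ∷ (⁅ x ⁆ ∪ ⁅ y ⁆))) ≡ + 2 * I
    in-sum = sum-pairs (supported-inside h)
    expand : ∀ x → sum (λ y → sum λ u → g (⁅ x ⁆ ∪ (⁅ y ⁆ ∪ ⁅ u ⁆))) ≡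
      (g (⁅ x ⁆ ∪ (⁅ zero ⁆ ∪ ⁅ zero ⁆)) + sum (λ u → g (⁅ x ⁆ ∪ (⁅ zero ⁆ ∪ ⁅ suc u ⁆)))) +
      (sum (λ y → g (⁅ x ⁆ ∪ (⁅ suc y ⁆ ∪ ⁅ zero ⁆))) + sum (λ y → sum λ u → g (⁅ x ⁆ ∪ (⁅ suc y ⁆ ∪ ⁅ suc u ⁆))))
    expand x = trans (sum-suc _) (cong₂ _+_ (sum-suc _) (trans (sum-cong λ y → sum-suc _) (sum-+ _ _)))
    vanish : ∀ {S S′} → S ≡ S′ → ∣ S′ ∣ ≢ 2 → g (inside ∷ S) ≡ 0ℤ
    vanish refl S′≢2 = supported-inside h _ S′≢2
    vanish-sum : ∀ {f : Fin n → Subset n} → (∀ x → f x ≡ ⁅ x ⁆) → sum (λ x → g (inside ∷ f x)) ≡ 0ℤ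
    vanish-sum f≡ = trans (sum-cong λ x → vanish (f≡ x) (λ e → contradiction (trans (sym (∣⁅x⁆∣≡1 x)) e) (λ ()))) (sum-0 n)

  -- Three-element sets as triples of distinct vertices.

  ∣p∣≡0⇒p≡⊥ : ∀ {n} (p : Subset n) → ∣ p ∣ ≡ 0 → p ≡ ⊥
  ∣p∣≡0⇒p≡⊥ []            e = refl
  ∣p∣≡0⇒p≡⊥ (outside ∷ p) e = cong (outside ∷_) (∣p∣≡0⇒p≡⊥ p e)

  -- Splits off the least element; three rounds of this name the vertices of a 3-set.
  insert : ∀ {n k} (p : Subset n) → ∣ p ∣ ≡ suc k →
    ∃[ x ] ∃[ q ] lookup q x ≡ outside × ∣ q ∣ ≡ k × p ≡ ⁅ x ⁆ ∪ q
  insert (inside ∷ p)  e = zero , outside ∷ p , refl , ℕₚ.suc-injective e , cong (inside ∷_) (sym (∪-identityˡ p))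
  insert (outside ∷ p) e with x , q , x∉q , e′ , refl ← insert p e = suc x , outside ∷ q , x∉q , e′ , refl

  lookup-⁅⁆ : ∀ {n} (x i : Fin n) → lookup ⁅ x ⁆ i ≡ does (x ≟ i)
  lookup-⁅⁆ zero    zero    = refl
  lookup-⁅⁆ zero    (suc i) = lookup-replicate i outside
  lookup-⁅⁆ (suc x) zero    = refl
  lookup-⁅⁆ (suc x) (suc i) = lookup-⁅⁆ x i

  ∣⁅x⁆∪p∣ : ∀ {n} (x : Fin n) (p : Subset n) → lookup p x ≡ outside → ∣ ⁅ x ⁆ ∪ p ∣ ≡ suc ∣ p ∣
  ∣⁅x⁆∪p∣ zero    (outside ∷ p) refl = cong (suc ∘ ∣_∣) (∪-identityˡ p)
  ∣⁅x⁆∪p∣ (suc x) (inside ∷ p)  e    = cong suc (∣⁅x⁆∪p∣ x p e)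
  ∣⁅x⁆∪p∣ (suc x) (outside ∷ p) e    = ∣⁅x⁆∪p∣ x p e

  Distinct : ∀ {n} → Fin n → Fin n → Fin n → Set
  Distinct x y u = x ≢ y × x ≢ u × y ≢ u

  ≢⇒lookup : ∀ {n} {x y : Fin n} → x ≢ y → lookup ⁅ y ⁆ x ≡ outside
  ≢⇒lookup {x = x} {y} x≢y = trans (lookup-⁅⁆ y x) (dec-false (y ≟ x) (x≢y ∘ sym))

  lookup⇒≢ : ∀ {n} {x y : Fin n} → lookup ⁅ y ⁆ x ≡ outside → x ≢ y
  lookup⇒≢ {x = x} e refl = contradiction (trans (sym (trans (lookup-⁅⁆ x x) (dec-true (x ≟ x) refl))) e) λ ()

  ∣triple∣≡3 : ∀ {n} {x y u : Fin n} → Distinct x y u → ∣ ⁅ x ⁆ ∪ (⁅ y ⁆ ∪ ⁅ u ⁆) ∣ ≡ 3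
  ∣triple∣≡3 {x = x} {y} {u} (x≢y , x≢u , y≢u) = trans
    (∣⁅x⁆∪p∣ x (⁅ y ⁆ ∪ ⁅ u ⁆) (trans (lookup-zipWith _∨_ x ⁅ y ⁆ ⁅ u ⁆) (cong₂ _∨_ (≢⇒lookup x≢y) (≢⇒lookup x≢u))))
    (cong suc (trans (∣⁅x⁆∪p∣ y ⁅ u ⁆ (≢⇒lookup y≢u)) (cong suc (∣⁅x⁆∣≡1 u))))

  ∣p∣≡3⇒triple : ∀ {n} (p : Subset n) → ∣ p ∣ ≡ 3 →
    ∃[ x ] ∃[ y ] ∃[ u ] Distinct x y u × p ≡ ⁅ x ⁆ ∪ (⁅ y ⁆ ∪ ⁅ u ⁆)
  ∣p∣≡3⇒triple p e
    with x , q , x∉q , e₂ , refl ← insert p e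
    with y , r , y∉r , e₁ , refl ← insert q e₂
    with u , s , u∉s , e₀ , refl ← insert r e₁
    with refl ← ∣p∣≡0⇒p≡⊥ s e₀
    = x , y , u ,
      ( lookup⇒≢ (∨-outside₁ (trans (sym (lookup-zipWith _∨_ x ⁅ y ⁆ (⁅ u ⁆ ∪ ⊥))) x∉q))
      , lookup⇒≢ (subst (λ t → lookup t x ≡ outside) (∪-identityʳ ⁅ u ⁆)
          (∨-outside₂ (lookup ⁅ y ⁆ x) (trans (sym (lookup-zipWith _∨_ x ⁅ y ⁆ (⁅ u ⁆ ∪ ⊥))) x∉q)))
      , lookup⇒≢ (subst (λ t → lookup t y ≡ outside) (∪-identityʳ ⁅ u ⁆) y∉r) )
    , cong (λ t → ⁅ x ⁆ ∪ (⁅ y ⁆ ∪ t)) (∪-identityʳ ⁅ u ⁆)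
    where
    ∨-outside₁ : ∀ {b c} → b ∨ c ≡ outside → b ≡ outside
    ∨-outside₁ {outside} e = refl
    ∨-outside₂ : ∀ b {c} → b ∨ c ≡ outside → c ≡ outside
    ∨-outside₂ outside e = e

  ⊆?-⊥ : ∀ {n} (p : Subset n) → does (⊥ ⊆? p) ≡ true
  ⊆?-⊥ []      = refl
  ⊆?-⊥ (_ ∷ p) = ⊆?-⊥ p

  ⊆?-⁅⁆ : ∀ {n} (x : Fin n) p → does (⁅ x ⁆ ⊆? p) ≡ lookup p x
  ⊆?-⁅⁆ zero    (inside ∷ p)  = ⊆?-⊥ p
  ⊆?-⁅⁆ zero    (outside ∷ p) = refl
  ⊆?-⁅⁆ (suc x) (_ ∷ p)       = ⊆?-⁅⁆ x p

  ⊆?-∪ : ∀ {n} (p q r : Subset n) → does (p ∪ q ⊆? r) ≡ does (p ⊆? r) ∧ does (q ⊆? r)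
  ⊆?-∪ []            []            []            = refl
  ⊆?-∪ (outside ∷ p) (outside ∷ q) (_ ∷ r)       = ⊆?-∪ p q r
  ⊆?-∪ (outside ∷ p) (inside ∷ q)  (inside ∷ r)  = ⊆?-∪ p q r
  ⊆?-∪ (outside ∷ p) (inside ∷ q)  (outside ∷ r) = sym (𝔹ₚ.∧-zeroʳ _)
  ⊆?-∪ (inside ∷ p)  (outside ∷ q) (inside ∷ r)  = ⊆?-∪ p q r
  ⊆?-∪ (inside ∷ p)  (outside ∷ q) (outside ∷ r) = refl
  ⊆?-∪ (inside ∷ p)  (inside ∷ q)  (inside ∷ r)  = ⊆?-∪ p q r
  ⊆?-∪ (inside ∷ p)  (inside ∷ q)  (outside ∷ r) = refl

  ⟦⟧-∧ : ∀ b c → ⟦ b ∧ c ⟧ ≡ ⟦ b ⟧ * ⟦ c ⟧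
  ⟦⟧-∧ true  true  = refl
  ⟦⟧-∧ true  false = refl
  ⟦⟧-∧ false c     = sym (*-zeroˡ ⟦ c ⟧)

  -- The δ of this name is Kronecker's, not the coboundary.
  sum-δ : ∀ {n} (x : Fin n) (f : Fin n → ℤ) → sum (λ i → ⟦ does (x ≟ i) ⟧ * f i) ≡ f x
  sum-δ {suc n} zero f = trans (sum-suc _) (trans (cong₂ _+_ (*-identityˡ (f zero)) (trans (sum-cong λ i → *-zeroˡ (f (suc i))) (sum-0 n))) (+-identityʳ (f zero)))
  sum-δ {suc n} (suc x) f = trans (sum-suc _) (trans (cong₂ _+_ (*-zeroˡ (f zero)) (sum-δ x (λ i → f (suc i)))) (+-identityˡ _))

  -- Since the vertices are distinct, the indicator of the union is the sum of three Kronecker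
  -- deltas.
  sum-triple : ∀ {n} {x y u : Fin n} → Distinct x y u → (f : Fin n → ℤ) →
    sum (λ i → ⟦ lookup (⁅ x ⁆ ∪ (⁅ y ⁆ ∪ ⁅ u ⁆)) i ⟧ * f i) ≡ f x + (f y + f u)
  sum-triple {x = x} {y} {u} (x≢y , x≢u , y≢u) f = trans (sum-cong λ i → trans (cong (_* f i) (indicator i))
      (trans (*-distribʳ-+ (f i) ⟦ does (x ≟ i) ⟧ (⟦ does (y ≟ i) ⟧ + ⟦ does (u ≟ i) ⟧))
        (cong (λ z → ⟦ does (x ≟ i) ⟧ * f i + z) (*-distribʳ-+ (f i) ⟦ does (y ≟ i) ⟧ ⟦ does (u ≟ i) ⟧))))
    (trans (sum-+ _ _) (cong₂ _+_ (sum-δ x f) (trans (sum-+ _ _) (cong₂ _+_ (sum-δ y f) (sum-δ u f)))))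
    where
    indicator : ∀ i → ⟦ lookup (⁅ x ⁆ ∪ (⁅ y ⁆ ∪ ⁅ u ⁆)) i ⟧ ≡ ⟦ does (x ≟ i) ⟧ + (⟦ does (y ≟ i) ⟧ + ⟦ does (u ≟ i) ⟧)
    indicator i rewrite lookup-zipWith _∨_ i ⁅ x ⁆ (⁅ y ⁆ ∪ ⁅ u ⁆) | lookup-zipWith _∨_ i ⁅ y ⁆ ⁅ u ⁆
      | lookup-⁅⁆ x i | lookup-⁅⁆ y i | lookup-⁅⁆ u i with x ≟ i | y ≟ i | u ≟ i
    ... | yes refl | yes refl | _        = contradiction refl x≢y
    ... | yes refl | no _     | yes refl = contradiction refl x≢u
    ... | yes _    | no _     | no _     = refl
    ... | no _     | yes refl | yes refl = contradiction refl y≢u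
    ... | no _     | yes _    | no _     = refl
    ... | no _     | no _     | yes _    = refl
    ... | no _     | no _     | no _     = refl

  -- Adjacency, coboundary and switching.

  mem-size : ∀ {d n} (E : System d n) {S} → ∣ S ∣ ≢ d → mem E S ≡ false
  mem-size E {S} S≢d with mem E S in eq
  ... | true  = contradiction (size E (subst T (sym eq) _)) S≢d
  ... | false = refl

  mem-supported : ∀ {d n} (E : System d n) → Supported d (λ S → ⟦ mem E S ⟧)
  mem-supported E S S≢d = cong ⟦_⟧ (mem-size E S≢d)

  card-sum : ∀ {d n} (E : System d n) → + card E ≡ sumₛ (λ S → ⟦ mem E S ⟧)
  card-sum E = count-subsets (λ S → T? (mem E S))

  adj : ∀ {n} → System 2 n → Fin n → Fin n → Bool
  adj E x y = mem E (⁅ x ⁆ ∪ ⁅ y ⁆)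

  adj-sym : ∀ {n} (E : System 2 n) x y → adj E x y ≡ adj E y x
  adj-sym E x y = cong (mem E) (∪-comm ⁅ x ⁆ ⁅ y ⁆)

  adj-irrefl : ∀ {n} (E : System 2 n) x → adj E x x ≡ false
  adj-irrefl E x = mem-size E λ e → contradiction
    (trans (sym (∣⁅x⁆∣≡1 x)) (trans (cong ∣_∣ (sym (∪-idem ⁅ x ⁆))) e)) λ ()

  sum-adj : ∀ {n} (E : System 2 n) → sum (λ x → sum λ y → ⟦ adj E x y ⟧) ≡ + 2 * + card E
  sum-adj E = trans (sum-pairs (mem-supported E)) (cong (+ 2 *_) (sym (card-sum E)))

  -- Twice the count is a sum over ordered pairs i, j in the triple. Of its nine terms the three
  -- diagonal ones vanish and the others agree in pairs.
  cardWithin-triple : ∀ {n} (E : System 2 n) {x y u} → Distinct x y u →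
    + cardWithin E (⁅ x ⁆ ∪ (⁅ y ⁆ ∪ ⁅ u ⁆)) ≡ ⟦ adj E x y ⟧ + (⟦ adj E x u ⟧ + ⟦ adj E y u ⟧)
  cardWithin-triple {n} E {x} {y} {u} dist = *-cancelˡ-≡ (+ 2) _ _ (begin
    + 2 * + cardWithin E U
      ≡⟨ cong (+ 2 *_) (count-subsets (λ S → T? (mem E S) ×-dec S ⊆? U)) ⟩
    + 2 * sumₛ (λ S → ⟦ mem E S ∧ does (S ⊆? U) ⟧)
      ≡⟨ sum-pairs (λ S S≢2 → cong (λ b → ⟦ b ∧ does (S ⊆? U) ⟧) (mem-size E S≢2)) ⟨
    sum (λ i → sum λ j → ⟦ adj E i j ∧ does (⁅ i ⁆ ∪ ⁅ j ⁆ ⊆? U) ⟧)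
      ≡⟨ sum-cong (λ i → trans (sum-cong λ j → split i j) (sum-*ˡ ⟦ lookup U i ⟧ _)) ⟩
    sum (λ i → ⟦ lookup U i ⟧ * sum (λ j → ⟦ lookup U j ⟧ * A i j))
      ≡⟨ sum-cong (λ i → cong (⟦ lookup U i ⟧ *_) (sum-triple dist (A i))) ⟩
    sum (λ i → ⟦ lookup U i ⟧ * (A i x + (A i y + A i u)))
      ≡⟨ sum-triple dist (λ i → A i x + (A i y + A i u)) ⟩
    (A x x + (A x y + A x u)) + ((A y x + (A y y + A y u)) + (A u x + (A u y + A u u)))
      ≡⟨ cong₂ _+_ (cong (_+ (A x y + A x u)) (A-irrefl x)) (cong₂ _+_ (cong₂ _+_ (A-sym y x) (cong (_+ A y u) (A-irrefl y)))
           (cong₂ _+_ (A-sym u x) (cong₂ _+_ (A-sym u y) (A-irrefl u)))) ⟩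
    (0ℤ + (A x y + A x u)) + ((A x y + (0ℤ + A y u)) + (A x u + (A y u + 0ℤ)))
      ≡⟨ solve 3 (λ a b c → (con 0ℤ :+ (a :+ b)) :+ ((a :+ (con 0ℤ :+ c)) :+ (b :+ (c :+ con 0ℤ))) := con (+ 2) :* (a :+ (b :+ c)))
           refl (A x y) (A x u) (A y u) ⟩
    + 2 * (A x y + (A x u + A y u)) ∎)
    where
    open ≡-Reasoning
    U = ⁅ x ⁆ ∪ (⁅ y ⁆ ∪ ⁅ u ⁆)
    A : Fin n → Fin n → ℤ
    A i j = ⟦ adj E i j ⟧
    A-irrefl : ∀ i → A i i ≡ 0ℤ
    A-irrefl i = cong ⟦_⟧ (adj-irrefl E i)
    A-sym : ∀ i j → A i j ≡ A j i
    A-sym i j = cong ⟦_⟧ (adj-sym E i j)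
    split : ∀ i j → ⟦ adj E i j ∧ does (⁅ i ⁆ ∪ ⁅ j ⁆ ⊆? U) ⟧ ≡ ⟦ lookup U i ⟧ * (⟦ lookup U j ⟧ * A i j)
    split i j = begin
      ⟦ adj E i j ∧ does (⁅ i ⁆ ∪ ⁅ j ⁆ ⊆? U) ⟧    ≡⟨ cong (λ b → ⟦ adj E i j ∧ b ⟧) (trans (⊆?-∪ ⁅ i ⁆ ⁅ j ⁆ U) (cong₂ _∧_ (⊆?-⁅⁆ i U) (⊆?-⁅⁆ j U))) ⟩
      ⟦ adj E i j ∧ (lookup U i ∧ lookup U j) ⟧    ≡⟨ trans (⟦⟧-∧ (adj E i j) _) (cong (A i j *_) (⟦⟧-∧ (lookup U i) (lookup U j))) ⟩
      A i j * (⟦ lookup U i ⟧ * ⟦ lookup U j ⟧)    ≡⟨ solve 3 (λ a b c → a :* (b :* c) := b :* (c :* a)) refl (A i j) ⟦ lookup U i ⟧ ⟦ lookup U j ⟧ ⟩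
      ⟦ lookup U i ⟧ * (⟦ lookup U j ⟧ * A i j)    ∎

  bit-parity : Bool → Parity
  bit-parity b = if b then 1ℙ else 0ℙ

  parity-sum : ∀ p q r {m} → + m ≡ ⟦ p ⟧ + (⟦ q ⟧ + ⟦ r ⟧) → parity m ≡ bit-parity (p xor (q xor r))
  parity-sum true  true  true  refl = refl
  parity-sum true  true  false refl = refl
  parity-sum true  false true  refl = refl
  parity-sum true  false false refl = refl
  parity-sum false true  true  refl = refl
  parity-sum false true  false refl = refl
  parity-sum false false true  refl = refl
  parity-sum false false false refl = refl

  odd-triple : ∀ {n} → System 2 n → Fin n → Fin n → Fin n → Bool
  odd-triple E x y u = adj E x y xor (adj E x u xor adj E y u)

  parity-cardWithin : ∀ {n} (E : System 2 n) {x y u} → Distinct x y u →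
    parity (cardWithin E (⁅ x ⁆ ∪ (⁅ y ⁆ ∪ ⁅ u ⁆))) ≡ bit-parity (odd-triple E x y u)
  parity-cardWithin E {x} {y} {u} dist = parity-sum (adj E x y) (adj E x u) (adj E y u) (cardWithin-triple E dist)

  mem-δ : ∀ {d n} (E : System d n) U → mem (δ E) U ≡ does (∣ U ∣ ℕₚ.≟ suc d) ∧ does (parity (cardWithin E U) ℙₚ.≟ 1ℙ)
  mem-δ E U = isYes≗does (δ-mem? E U)

  -- If two of the vertices coincide, their adjacency is `false` and their adjacencies to the third
  -- are equal, so the sum modulo 2 is `false`.
  odd-distinct : ∀ {n} (E : System 2 n) {x y u} → odd-triple E x y u ≡ true → Distinct x y u
  odd-distinct E {x} {y} {u} odd = x≢y , x≢u , y≢u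
    where
    xx = adj-irrefl E
    x≢y : x ≢ y
    x≢y refl = contradiction (trans (sym (trans (cong (_xor (adj E x u xor adj E x u)) (xx x)) (𝔹ₚ.xor-same (adj E x u)))) odd) λ ()
    x≢u : x ≢ u
    x≢u refl = contradiction (trans (sym (trans (cong₂ (λ b c → adj E x y xor (b xor c)) (xx x) (adj-sym E y x)) (𝔹ₚ.xor-same (adj E x y)))) odd) λ ()
    y≢u : y ≢ u
    y≢u refl = contradiction (trans (sym (trans (cong (λ b → adj E x y xor (adj E x y xor b)) (xx y))
      (trans (cong (adj E x y xor_) (𝔹ₚ.xor-identityʳ (adj E x y))) (𝔹ₚ.xor-same (adj E x y))))) odd) λ ()

  odd⇒mem-δ : ∀ {n} (E : System 2 n) {x y u} → odd-triple E x y u ≡ true → mem (δ E) (⁅ x ⁆ ∪ (⁅ y ⁆ ∪ ⁅ u ⁆)) ≡ true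
  odd⇒mem-δ E {x} {y} {u} odd = trans (mem-δ E U) (cong₂ _∧_ (dec-true (∣ U ∣ ℕₚ.≟ 3) (∣triple∣≡3 dist))
    (dec-true (parity (cardWithin E U) ℙₚ.≟ 1ℙ) (trans (parity-cardWithin E dist) (cong bit-parity odd))))
    where
    U = ⁅ x ⁆ ∪ (⁅ y ⁆ ∪ ⁅ u ⁆)
    dist = odd-distinct E odd

  -- This direction carries lower bounds for T over to the coboundary. Odd tuples consist of
  -- distinct vertices, and `sum-triples` counts each 3-set six times.
  sum-odd≤6∣δE∣ : ∀ {n} (E : System 2 n) →
    sum (λ x → sum λ y → sum λ u → ⟦ odd-triple E x y u ⟧) ≤ + 6 * + card (δ E)
  sum-odd≤6∣δE∣ E = ≤-trans (sum-mono λ x → sum-mono λ y → sum-mono λ u → implies (odd⇒mem-δ E))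
    (≤-reflexive (trans (sum-triples (mem-supported (δ E))) (cong (+ 6 *_) (sym (card-sum (δ E))))))
    where
    implies : ∀ {b c} → (b ≡ true → c ≡ true) → ⟦ b ⟧ ≤ ⟦ c ⟧
    implies {true}  {c} h = ≤-reflexive (cong ⟦_⟧ (sym (h refl)))
    implies {false} {true} h = +≤+ ℕ.z≤n
    implies {false} {false} h = +≤+ ℕ.z≤n

  -- The parity of the number of elements of a subset that satisfy s.
  flips : ∀ {n} → (Fin n → Bool) → Subset n → Bool
  flips s []      = false
  flips s (b ∷ p) = (b ∧ s zero) xor flips (s ∘ suc) p

  flips-⊥ : ∀ {n} (s : Fin n → Bool) → flips s ⊥ ≡ false
  flips-⊥ {zero}  s = refl
  flips-⊥ {suc n} s = flips-⊥ (s ∘ suc)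

  flips-⁅⁆ : ∀ {n} (s : Fin n → Bool) x → flips s ⁅ x ⁆ ≡ s x
  flips-⁅⁆ s zero    = trans (cong (s zero xor_) (flips-⊥ (s ∘ suc))) (𝔹ₚ.xor-identityʳ (s zero))
  flips-⁅⁆ s (suc x) = flips-⁅⁆ (s ∘ suc) x

  flips-pair : ∀ {n} (s : Fin n → Bool) {x y} → x ≢ y → flips s (⁅ x ⁆ ∪ ⁅ y ⁆) ≡ s x xor s y
  flips-pair s {zero}  {zero}  x≢y = contradiction refl x≢y
  flips-pair s {zero}  {suc y} x≢y = cong (s zero xor_) (trans (cong (flips (s ∘ suc)) (∪-identityˡ ⁅ y ⁆)) (flips-⁅⁆ (s ∘ suc) y))
  flips-pair s {suc x} {zero}  x≢y = trans (cong (s zero xor_) (trans (cong (flips (s ∘ suc)) (∪-identityʳ ⁅ x ⁆)) (flips-⁅⁆ (s ∘ suc) x)))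
    (𝔹ₚ.xor-comm (s zero) (s (suc x)))
  flips-pair s {suc x} {suc y} x≢y = flips-pair (s ∘ suc) (λ e → x≢y (cong suc e))

  -- The symmetric difference of E and the cut of s.
  switch : ∀ {n} → System 2 n → (Fin n → Bool) → System 2 n
  switch E s .mem U = does (∣ U ∣ ℕₚ.≟ 2) ∧ (mem E U xor flips s U)
  switch E s .size {U} = witness (∣ U ∣ ℕₚ.≟ 2)
    where
    witness : ∀ {P : Set} (P? : Dec P) {b} → T (does P? ∧ b) → P
    witness (yes p) _ = p

  adj-switch : ∀ {n} (E : System 2 n) s {x y} → x ≢ y → adj (switch E s) x y ≡ adj E x y xor (s x xor s y)
  adj-switch E s {x} {y} x≢y = cong₂ _∧_
    (dec-true (∣ ⁅ x ⁆ ∪ ⁅ y ⁆ ∣ ℕₚ.≟ 2) (trans (∣⁅x⁆∪p∣ x ⁅ y ⁆ (≢⇒lookup x≢y)) (cong suc (∣⁅x⁆∣≡1 y))))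
    (cong (adj E x y xor_) (flips-pair s x≢y))

  -- Each vertex of a triple lies in two of its three pairs, so its side of the cut cancels from the
  -- parity.
  δ-switch : ∀ {n} (E : System 2 n) s → δ E ≐ δ (switch E s)
  δ-switch E s U = trans (mem-δ E U) (trans (step (∣ U ∣ ℕₚ.≟ 3)) (sym (mem-δ (switch E s) U)))
    where
    -- `∀-graph?` serves as a check over six Booleans: three adjacencies and three sides of the cut.
    xor-cancel : ∀ p q r i j k →
      p xor (q xor r) ≡ (p xor (i xor j)) xor ((q xor (i xor k)) xor (r xor (j xor k)))
    xor-cancel = toWitness {a? = ∀-graph? λ p q r i j k →
      (p xor (q xor r)) 𝔹ₚ.≟ ((p xor (i xor j)) xor ((q xor (i xor k)) xor (r xor (j xor k))))} _
    parity-switch : ∣ U ∣ ≡ 3 → parity (cardWithin E U) ≡ parity (cardWithin (switch E s) U)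
    parity-switch e with x , y , u , dist@(x≢y , x≢u , y≢u) , refl ← ∣p∣≡3⇒triple U e = begin
      parity (cardWithin E V)                  ≡⟨ parity-cardWithin E dist ⟩
      bit-parity (odd-triple E x y u)          ≡⟨ cong bit-parity (trans (xor-cancel (adj E x y) (adj E x u) (adj E y u) (s x) (s y) (s u))
                                                    (sym (cong₂ _xor_ (adj-switch E s x≢y) (cong₂ _xor_ (adj-switch E s x≢u) (adj-switch E s y≢u))))) ⟩
      bit-parity (odd-triple (switch E s) x y u) ≡⟨ parity-cardWithin (switch E s) dist ⟨
      parity (cardWithin (switch E s) V)       ∎
      where
      open ≡-Reasoning
      V = ⁅ x ⁆ ∪ (⁅ y ⁆ ∪ ⁅ u ⁆)
    step : (d : Dec (∣ U ∣ ≡ 3)) →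
      does d ∧ does (parity (cardWithin E U) ℙₚ.≟ 1ℙ) ≡ does d ∧ does (parity (cardWithin (switch E s) U) ℙₚ.≟ 1ℙ)
    step (yes e) = cong (λ p → does (p ℙₚ.≟ 1ℙ)) (parity-switch e)
    step (no _)  = refl

  cut-nonpos : ∀ {n} (E : System 2 n) s → card E ℕ.≤ card (switch E s) →
    sum (λ x → sum λ y → ⟦ s x xor s y ⟧ * (+ 2 * ⟦ adj E x y ⟧ - 1ℤ)) ≤ 0ℤ
  cut-nonpos {n} E s E≤E′ = begin
    sum (λ x → sum λ y → ⟦ s x xor s y ⟧ * (+ 2 * ⟦ adj E x y ⟧ - 1ℤ))
      ≡⟨ sum-cong (λ x → trans (sum-cong (difference x)) (sum-+ _ _)) ⟩
    sum (λ x → sum (λ y → ⟦ adj E x y ⟧) + sum (λ y → -1ℤ * ⟦ adj (switch E s) x y ⟧))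
      ≡⟨ trans (sum-+ _ _) (cong (λ z → sum (λ x → sum λ y → ⟦ adj E x y ⟧) + z) (trans (sum-cong λ x → sum-*ˡ -1ℤ _) (sum-*ˡ -1ℤ _))) ⟩
    sum (λ x → sum λ y → ⟦ adj E x y ⟧) + -1ℤ * sum (λ x → sum λ y → ⟦ adj (switch E s) x y ⟧)
      ≡⟨ cong₂ (λ i j → i + -1ℤ * j) (sum-adj E) (sum-adj (switch E s)) ⟩
    + 2 * + card E + -1ℤ * (+ 2 * + card (switch E s))
      ≡⟨ cong (λ z → + 2 * + card E + z) (-1*i≡-i _) ⟩
    + 2 * + card E - + 2 * + card (switch E s)
      ≤⟨ i≤j⇒i-j≤0 (*-monoˡ-≤-nonNeg (+ 2) (+≤+ E≤E′)) ⟩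
    0ℤ ∎
    where
    open ≤-Reasoning
    -- Across the cut, switching changes an adjacency b to 1 - b, a loss of 2b - 1. The sum over the
    -- cut is thus the total loss 2|E| - 2|E′| in ordered pairs.
    check : ∀ b c → ⟦ c ⟧ * (+ 2 * ⟦ b ⟧ - 1ℤ) ≡ ⟦ b ⟧ + -1ℤ * ⟦ b xor c ⟧
    check true  true  = refl
    check true  false = refl
    check false true  = refl
    check false false = refl
    difference : ∀ x y → ⟦ s x xor s y ⟧ * (+ 2 * ⟦ adj E x y ⟧ - 1ℤ) ≡ ⟦ adj E x y ⟧ + -1ℤ * ⟦ adj (switch E s) x y ⟧
    difference x y with x ≟ y
    ... | no x≢y  = trans (check (adj E x y) (s x xor s y)) (cong (λ b → ⟦ adj E x y ⟧ + -1ℤ * ⟦ b ⟧) (sym (adj-switch E s x≢y)))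
    ... | yes refl = trans (cong (λ b → ⟦ b ⟧ * (+ 2 * ⟦ adj E x x ⟧ - 1ℤ)) (𝔹ₚ.xor-same (s x)))
      (trans (*-zeroˡ (+ 2 * ⟦ adj E x x ⟧ - 1ℤ)) (sym (cong₂ (λ b c → ⟦ b ⟧ + -1ℤ * ⟦ c ⟧) (adj-irrefl E x) (adj-irrefl (switch E s) x))))

-- Rational arithmetic, densities and the passage to the limit.

module Densities where
  open import Data.Integer.Base as ℤ using (ℤ)
  import Data.Integer.Properties as ℤₚ
  open import Data.Nat.Base as ℕ using (ℕ; zero; suc)
  open import Data.Nat.Combinatorics using (_C_; nC1≡n; nCk+nC[k+1]≡[n+1]C[k+1])
  import Data.Nat.Properties as ℕₚ
  open import Data.Nat.Solver using (module +-*-Solver)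
  open import Data.Rational
  open import Data.Rational.Properties
  import Data.Rational.Solver as ℚ-Solver
  import Data.Rational.Unnormalised.Base as ℚᵘ
  import Data.Rational.Unnormalised.Properties as ℚᵘₚ
  open import Data.Sum.Base using (_⊎_; inj₁; inj₂; [_,_]′)
  open import Relation.Nullary using (yes; no; contradiction)
  open ℚ-Solver.+-*-Solver using (solve; con; _:=_; _:+_; _:*_; _:-_)
  open RationalLemmas
  open GraphInequality using (module Graph)
  open PairSystems

  ι : ℤ → ℚ
  ι i = i / 1

  toℚᵘ-ι : ∀ i → toℚᵘ (ι i) ℚᵘ.≃ ℚᵘ.mkℚᵘ i 0
  toℚᵘ-ι i = toℚᵘ-fromℚᵘ (ℚᵘ.mkℚᵘ i 0)

  ι-+ : ∀ i j → ι (i ℤ.+ j) ≡ ι i + ι j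
  ι-+ i j = toℚᵘ-injective (begin
    toℚᵘ (ι (i ℤ.+ j))                   ≈⟨ toℚᵘ-ι (i ℤ.+ j) ⟩
    ℚᵘ.mkℚᵘ (i ℤ.+ j) 0                  ≈⟨ ℚᵘ.*≡* (cong (ℤ._* + 1) (cong₂ ℤ._+_ (ℤₚ.*-identityʳ i) (ℤₚ.*-identityʳ j))) ⟨
    ℚᵘ.mkℚᵘ i 0 ℚᵘ.+ ℚᵘ.mkℚᵘ j 0         ≈⟨ ℚᵘₚ.+-cong (toℚᵘ-ι i) (toℚᵘ-ι j) ⟨
    toℚᵘ (ι i) ℚᵘ.+ toℚᵘ (ι j)           ≈⟨ toℚᵘ-homo-+ (ι i) (ι j) ⟨
    toℚᵘ (ι i + ι j)                     ∎)
    where open ℚᵘₚ.≃-Reasoning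

  ι-* : ∀ i j → ι (i ℤ.* j) ≡ ι i * ι j
  ι-* i j = toℚᵘ-injective (begin
    toℚᵘ (ι (i ℤ.* j))                   ≈⟨ toℚᵘ-ι (i ℤ.* j) ⟩
    ℚᵘ.mkℚᵘ i 0 ℚᵘ.* ℚᵘ.mkℚᵘ j 0         ≈⟨ ℚᵘₚ.*-cong (toℚᵘ-ι i) (toℚᵘ-ι j) ⟨
    toℚᵘ (ι i) ℚᵘ.* toℚᵘ (ι j)           ≈⟨ toℚᵘ-homo-* (ι i) (ι j) ⟨
    toℚᵘ (ι i * ι j)                     ∎)
    where open ℚᵘₚ.≃-Reasoning

  ι-neg : ∀ i → ι (ℤ.- i) ≡ - ι i
  ι-neg i = toℚᵘ-injective (begin
    toℚᵘ (ι (ℤ.- i))                     ≈⟨ toℚᵘ-ι (ℤ.- i) ⟩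
    ℚᵘ.- ℚᵘ.mkℚᵘ i 0                     ≈⟨ ℚᵘₚ.-‿cong (toℚᵘ-ι i) ⟨
    ℚᵘ.- toℚᵘ (ι i)                      ≈⟨ toℚᵘ-homo‿- (ι i) ⟨
    toℚᵘ (- ι i)                         ∎)
    where open ℚᵘₚ.≃-Reasoning

  ι-sub : ∀ i j → ι (i ℤ.- j) ≡ ι i - ι j
  ι-sub i j = trans (ι-+ i (ℤ.- j)) (cong (λ k → ι i + k) (ι-neg j))

  ι-mono : ∀ {i j} → i ℤ.≤ j → ι i ≤ ι j
  ι-mono {i} {j} i≤j = toℚᵘ-cancel-≤ (ℚᵘₚ.≤-respˡ-≃ (ℚᵘₚ.≃-sym (toℚᵘ-ι i)) (ℚᵘₚ.≤-respʳ-≃ (ℚᵘₚ.≃-sym (toℚᵘ-ι j))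
    (ℚᵘ.*≤* (subst₂ ℤ._≤_ (sym (ℤₚ.*-identityʳ i)) (sym (ℤₚ.*-identityʳ j)) i≤j))))

  ι-cancel-≤ : ∀ {i j} → ι i ≤ ι j → i ℤ.≤ j
  ι-cancel-≤ {i} {j} h with ℚᵘ.*≤* i≤j ← ℚᵘₚ.≤-respˡ-≃ (toℚᵘ-ι i) (ℚᵘₚ.≤-respʳ-≃ (toℚᵘ-ι j) (toℚᵘ-mono-≤ h))
    = subst₂ ℤ._≤_ (ℤₚ.*-identityʳ i) (ℤₚ.*-identityʳ j) i≤j

  ι-pos : ∀ n .{{_ : ℕ.NonZero n}} → 0ℚ < ι (+ n)
  ι-pos (suc n) = positive⁻¹ _ {{normalize-pos (suc n) 1}}

  ratio-* : ∀ a n .{{_ : ℕ.NonZero n}} → ratio a n * ι (+ n) ≡ ι (+ a)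
  ratio-* a (suc n) = toℚᵘ-injective (begin
    toℚᵘ (+ a / suc n * ι (+ suc n))     ≈⟨ toℚᵘ-homo-* (+ a / suc n) (ι (+ suc n)) ⟩
    toℚᵘ (+ a / suc n) ℚᵘ.* toℚᵘ (ι (+ suc n)) ≈⟨ ℚᵘₚ.*-cong (toℚᵘ-fromℚᵘ (ℚᵘ.mkℚᵘ (+ a) n)) (toℚᵘ-ι (+ suc n)) ⟩
    ℚᵘ.mkℚᵘ (+ a) n ℚᵘ.* ℚᵘ.mkℚᵘ (+ suc n) 0 ≈⟨ ℚᵘ.*≡* (trans (ℤₚ.*-identityʳ _) (cong (λ k → + a ℤ.* + suc k) (sym (ℕₚ.*-identityʳ n)))) ⟩
    ℚᵘ.mkℚᵘ (+ a) 0                      ≈⟨ toℚᵘ-ι (+ a) ⟨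
    toℚᵘ (ι (+ a))                       ∎)
    where open ℚᵘₚ.≃-Reasoning

  ratio-nonneg : ∀ a n → 0ℚ ≤ ratio a n
  ratio-nonneg a zero    = ≤-refl
  ratio-nonneg a (suc n) = RationalLemmas.nonneg-/ a n

  ratio-cancel-≤ : ∀ {a b} n .{{_ : ℕ.NonZero n}} → ratio a n ≤ ratio b n → a ℕ.≤ b
  ratio-cancel-≤ {a} {b} n h = ℤₚ.drop‿+≤+ (ι-cancel-≤ (subst₂ _≤_ (ratio-* a n) (ratio-* b n)
    (*-monoʳ-≤-nonNeg (ι (+ n)) {{nonNegative (<⇒≤ (ι-pos n))}} h)))

  C-suc : ∀ n k → suc n C suc k ≡ n C k ℕ.+ n C suc k
  C-suc n k = sym (nCk+nC[k+1]≡[n+1]C[k+1] n k)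

  2*[nC2]+n≡n*n : ∀ n → 2 ℕ.* (n C 2) ℕ.+ n ≡ n ℕ.* n
  2*[nC2]+n≡n*n zero    = refl
  2*[nC2]+n≡n*n (suc n) = begin
    2 ℕ.* (suc n C 2) ℕ.+ suc n              ≡⟨ cong (λ c → 2 ℕ.* c ℕ.+ suc n) (trans (C-suc n 1) (cong (ℕ._+ n C 2) (nC1≡n n))) ⟩
    2 ℕ.* (n ℕ.+ n C 2) ℕ.+ suc n            ≡⟨ S.solve 2 (λ n c → S.con 2 S.:* (n S.:+ c) S.:+ (S.con 1 S.:+ n)
                                                 S.:= (S.con 2 S.:* c S.:+ n) S.:+ (S.con 2 S.:* n S.:+ S.con 1)) refl n (n C 2) ⟩
    (2 ℕ.* (n C 2) ℕ.+ n) ℕ.+ (2 ℕ.* n ℕ.+ 1) ≡⟨ cong (ℕ._+ (2 ℕ.* n ℕ.+ 1)) (2*[nC2]+n≡n*n n) ⟩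
    n ℕ.* n ℕ.+ (2 ℕ.* n ℕ.+ 1)              ≡⟨ S.solve 1 (λ n → n S.:* n S.:+ (S.con 2 S.:* n S.:+ S.con 1) S.:= (S.con 1 S.:+ n) S.:* (S.con 1 S.:+ n)) refl n ⟩
    suc n ℕ.* suc n                          ∎
    where open ≡-Reasoning
          module S = +-*-Solver

  6*[nC3]≤n³ : ∀ n → 6 ℕ.* (n C 3) ℕ.≤ n ℕ.* (n ℕ.* n)
  6*[nC3]≤n³ zero    = ℕ.z≤n
  6*[nC3]≤n³ (suc n) = begin
    6 ℕ.* (suc n C 3)                        ≡⟨ cong (6 ℕ.*_) (C-suc n 2) ⟩
    6 ℕ.* (n C 2 ℕ.+ n C 3)                  ≡⟨ S.solve 2 (λ c d → S.con 6 S.:* (c S.:+ d) S.:= S.con 3 S.:* (S.con 2 S.:* c) S.:+ S.con 6 S.:* d) refl (n C 2) (n C 3) ⟩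
    3 ℕ.* (2 ℕ.* (n C 2)) ℕ.+ 6 ℕ.* (n C 3)  ≤⟨ ℕₚ.+-mono-≤ (ℕₚ.*-monoʳ-≤ 3 (ℕₚ.m+n≤o⇒m≤o (2 ℕ.* (n C 2)) (ℕₚ.≤-reflexive (2*[nC2]+n≡n*n n)))) (6*[nC3]≤n³ n) ⟩
    3 ℕ.* (n ℕ.* n) ℕ.+ n ℕ.* (n ℕ.* n)      ≤⟨ ℕₚ.m≤m+n _ (3 ℕ.* n ℕ.+ 1) ⟩
    3 ℕ.* (n ℕ.* n) ℕ.+ n ℕ.* (n ℕ.* n) ℕ.+ (3 ℕ.* n ℕ.+ 1)
      ≡⟨ S.solve 1 (λ n → S.con 3 S.:* (n S.:* n) S.:+ n S.:* (n S.:* n) S.:+ (S.con 3 S.:* n S.:+ S.con 1)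
           S.:= (S.con 1 S.:+ n) S.:* ((S.con 1 S.:+ n) S.:* (S.con 1 S.:+ n))) refl n ⟩
    suc n ℕ.* (suc n ℕ.* suc n)              ∎
    where open ℕₚ.≤-Reasoning
          module S = +-*-Solver

  nC2≢0 : ∀ n → 2 ℕ.≤ n → ℕ.NonZero (n C 2)
  nC2≢0 (suc (suc n)) _ = ℕ.>-nonZero (subst (0 ℕ.<_) (sym (C-suc (suc n) 1))
    (ℕₚ.<-≤-trans (subst (0 ℕ.<_) (sym (nC1≡n (suc n))) (ℕ.s≤s ℕ.z≤n)) (ℕₚ.m≤m+n (suc n C 1) _)))
  nC2≢0 (suc zero) (ℕ.s≤s ())

  nC3≢0 : ∀ n → 3 ℕ.≤ n → ℕ.NonZero (n C 3)
  nC3≢0 (suc n) (ℕ.s≤s 2≤n) = ℕ.>-nonZero (subst (0 ℕ.<_) (sym (C-suc n 2))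
    (ℕₚ.<-≤-trans (ℕ.>-nonZero⁻¹ (n C 2) {{nC2≢0 n 2≤n}}) (ℕₚ.m≤m+n (n C 2) _)))

  p≤q⇒0≤q-p : ∀ {p q} → p ≤ q → 0ℚ ≤ q - p
  p≤q⇒0≤q-p {p} {q} p≤q = subst (_≤ q - p) (+-inverseʳ p) (+-monoˡ-≤ (- p) p≤q)

  0≤q-p⇒p≤q : ∀ {p q} → 0ℚ ≤ q - p → p ≤ q
  0≤q-p⇒p≤q {p} {q} h = subst₂ _≤_ (+-identityˡ p) (solve 2 (λ p q → q :- p :+ p := q) refl p q) (+-monoˡ-≤ p h)

  cancel-* : ∀ {p q} r → 0ℚ < r → r * p ≤ r * q → p ≤ q
  cancel-* r 0<r = *-cancelˡ-≤-pos r {{positive 0<r}}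

  mono-* : ∀ {p q} r → 0ℚ ≤ r → p ≤ q → r * p ≤ r * q
  mono-* r 0≤r = *-monoˡ-≤-nonNeg r {{nonNegative 0≤r}}

  2/₁ 3/₁ 9/₁ 3/₂ : ℚ
  2/₁ = + 2 / 1
  3/₁ = + 3 / 1
  9/₁ = + 9 / 1
  3/₂ = + 3 / 2

  -- For σ = T/(Ne), the inequality (3Ne − T)(3Ne − 2T) ≤ 9e³ gives N³ cubic σ ≤ 9T.
  cubic : ℚ → ℚ
  cubic σ = σ * ((3/₁ - σ) * (3/₁ - 2/₁ * σ))

  -- The difference is ρ - σ times a quotient which `factor` writes as a sum of terms that are
  -- nonnegative for 1 ≤ σ ≤ ρ ≤ 3/2.
  cubic-antitone : ∀ {σ ρ} → 1ℚ ≤ σ → σ ≤ ρ → ρ ≤ 3/₂ → cubic ρ ≤ cubic σ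
  cubic-antitone {σ} {ρ} 1≤σ σ≤ρ ρ≤3/2 = 0≤q-p⇒p≤q (subst (0ℚ ≤_) (sym factor)
    (*-nonneg (p≤q⇒0≤q-p σ≤ρ) (+-mono-≤ (+-mono-≤ (+-mono-≤ (+-mono-≤
      (*-nonneg 0≤2 (*-nonneg 0≤σ-1 (p≤q⇒0≤q-p (≤-trans σ≤ρ ρ≤3/2))))
      (*-nonneg 0≤2 (*-nonneg (p≤q⇒0≤q-p 1≤ρ) 0≤3/2-ρ)))
      (*-nonneg 0≤2 (*-nonneg 0≤σ-1 0≤3/2-ρ)))
      (≤-trans 0≤1 1≤σ))
      (*-nonneg 0≤2 (≤-trans 0≤1 1≤ρ)))))
    where
    0≤1 = toWitness {a? = 0ℚ ≤? 1ℚ} _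
    0≤2 = toWitness {a? = 0ℚ ≤? 2/₁} _
    1≤ρ = ≤-trans 1≤σ σ≤ρ
    0≤σ-1 = p≤q⇒0≤q-p 1≤σ
    0≤3/2-ρ = p≤q⇒0≤q-p ρ≤3/2
    factor : cubic σ - cubic ρ ≡ (ρ - σ) *
      (2/₁ * ((σ - 1ℚ) * (3/₂ - σ)) + 2/₁ * ((ρ - 1ℚ) * (3/₂ - ρ)) + 2/₁ * ((σ - 1ℚ) * (3/₂ - ρ)) + σ + 2/₁ * ρ)
    factor = solve 2 (λ σ ρ →
      σ :* ((con 3/₁ :- σ) :* (con 3/₁ :- con 2/₁ :* σ)) :- ρ :* ((con 3/₁ :- ρ) :* (con 3/₁ :- con 2/₁ :* ρ)) :=
      (ρ :- σ) :* (con 2/₁ :* ((σ :- con 1ℚ) :* (con 3/₂ :- σ)) :+ con 2/₁ :* ((ρ :- con 1ℚ) :* (con 3/₂ :- ρ))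
        :+ con 2/₁ :* ((σ :- con 1ℚ) :* (con 3/₂ :- ρ)) :+ σ :+ con 2/₁ :* ρ)) refl σ ρ

  -- Put σ = T/(Ne), so that 1 ≤ σ. If ρ ≤ σ, then T = σNe with e ≥ bN² suffices. If σ ≤ ρ, then 9T
  -- ≥ N³ `cubic σ` ≥ N³ `cubic ρ` ≥ 9ρbN³, the first step by the main inequality divided by e³.
  triples-bound : ∀ {N e T ρ b} → 0ℚ < N → 0ℚ < b → b * (N * N) ≤ e →
    N * e ≤ T →
    e * ((3/₁ * (N * e) - T) * (3/₁ * (N * e) - 2/₁ * T)) ≤ e * (9/₁ * (e * (e * e))) →
    0ℚ ≤ ρ → ρ ≤ 3/₂ → 9/₁ * b ≤ (3/₁ - ρ) * (3/₁ - 2/₁ * ρ) →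
    ρ * b * (N * (N * N)) ≤ T
  triples-bound {N} {e} {T} {ρ} {b} 0<N 0<b bN²≤e Ne≤T main 0≤ρ ρ≤3/2 9b≤ = result
    where
    open ≤-Reasoning
    0<N² = *-pos 0<N 0<N
    0<e : 0ℚ < e
    0<e = <-≤-trans (*-pos 0<b 0<N²) bN²≤e
    0<M : 0ℚ < N * e
    0<M = *-pos 0<N 0<e
    instance
      M≢0 : NonZero (N * e)
      M≢0 = pos⇒nonZero (N * e) {{positive 0<M}}
    σ = T * 1/ (N * e)
    T≡ : T ≡ σ * (N * e)
    T≡ = sym (trans (*-assoc T (1/ (N * e)) (N * e)) (trans (cong (T *_) (*-inverseˡ (N * e))) (*-identityʳ T)))
    1≤σ : 1ℚ ≤ σ
    1≤σ = cancel-* (N * e) 0<M (subst₂ _≤_ (sym (*-identityʳ (N * e))) (trans T≡ (*-comm σ (N * e))) Ne≤T)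
    0≤σ = ≤-trans (toWitness {a? = 0ℚ ≤? 1ℚ} _) 1≤σ

    reduced : N * N * ((3/₁ - σ) * (3/₁ - 2/₁ * σ)) ≤ 9/₁ * e
    reduced = cancel-* (e * (e * e)) (*-pos 0<e (*-pos 0<e 0<e)) (begin
      e * (e * e) * (N * N * ((3/₁ - σ) * (3/₁ - 2/₁ * σ)))
        ≡⟨ solve 3 (λ e n s → e :* (e :* e) :* (n :* n :* ((con 3/₁ :- s) :* (con 3/₁ :- con 2/₁ :* s))) :=
             e :* ((con 3/₁ :* (n :* e) :- s :* (n :* e)) :* (con 3/₁ :* (n :* e) :- con 2/₁ :* (s :* (n :* e))))) refl e N σ ⟩
      e * ((3/₁ * (N * e) - σ * (N * e)) * (3/₁ * (N * e) - 2/₁ * (σ * (N * e))))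
        ≡⟨ cong (λ t → e * ((3/₁ * (N * e) - t) * (3/₁ * (N * e) - 2/₁ * t))) (sym T≡) ⟩
      e * ((3/₁ * (N * e) - T) * (3/₁ * (N * e) - 2/₁ * T))
        ≤⟨ main ⟩
      e * (9/₁ * (e * (e * e)))
        ≡⟨ solve 1 (λ e → e :* (con 9/₁ :* (e :* (e :* e))) := e :* (e :* e) :* (con 9/₁ :* e)) refl e ⟩
      e * (e * e) * (9/₁ * e) ∎)

    result : ρ * b * (N * (N * N)) ≤ T
    result with ≤-total ρ σ
    ... | inj₁ ρ≤σ = begin
      ρ * b * (N * (N * N))   ≡⟨ solve 3 (λ r b n → r :* b :* (n :* (n :* n)) := r :* (n :* (b :* (n :* n)))) refl ρ b N ⟩
      ρ * (N * (b * (N * N))) ≤⟨ mono-* ρ 0≤ρ (mono-* N (<⇒≤ 0<N) bN²≤e) ⟩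
      ρ * (N * e)             ≤⟨ *-monoʳ-≤-nonNeg (N * e) {{nonNegative (<⇒≤ 0<M)}} ρ≤σ ⟩
      σ * (N * e)             ≡⟨ T≡ ⟨
      T                       ∎
    ... | inj₂ σ≤ρ = cancel-* 9/₁ (toWitness {a? = 0ℚ <? 9/₁} _) (begin
      9/₁ * (ρ * b * (N * (N * N)))   ≡⟨ solve 3 (λ r b n → con 9/₁ :* (r :* b :* (n :* (n :* n))) := n :* (n :* n) :* r :* (con 9/₁ :* b)) refl ρ b N ⟩
      N * (N * N) * ρ * (9/₁ * b)     ≤⟨ mono-* (N * (N * N) * ρ) (*-nonneg (<⇒≤ (*-pos 0<N 0<N²)) 0≤ρ) 9b≤ ⟩
      N * (N * N) * ρ * ((3/₁ - ρ) * (3/₁ - 2/₁ * ρ)) ≡⟨ *-assoc (N * (N * N)) ρ _ ⟩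
      N * (N * N) * cubic ρ           ≤⟨ mono-* (N * (N * N)) (<⇒≤ (*-pos 0<N 0<N²)) (cubic-antitone 1≤σ σ≤ρ ρ≤3/2) ⟩
      N * (N * N) * cubic σ           ≡⟨ solve 3 (λ n s c → n :* (n :* n) :* (s :* c) := s :* (n :* (n :* n :* c))) refl N σ ((3/₁ - σ) * (3/₁ - 2/₁ * σ)) ⟩
      σ * (N * (N * N * ((3/₁ - σ) * (3/₁ - 2/₁ * σ)))) ≤⟨ mono-* σ 0≤σ (mono-* N (<⇒≤ 0<N) reduced) ⟩
      σ * (N * (9/₁ * e))             ≡⟨ solve 3 (λ s n e → s :* (n :* (con 9/₁ :* e)) := con 9/₁ :* (s :* (n :* e))) refl σ N e ⟩
      9/₁ * (σ * (N * e))             ≡⟨ cong (9/₁ *_) T≡ ⟨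
      9/₁ * T                         ∎)

  -- The slack `η` absorbs the gap between the n² - n ordered pairs of distinct vertices and n²: (b
  -- + η)(n² - n) ≥ bn² amounts to b + η ≤ ηn. For triples 6(n C 3) ≤ n³ goes the right way.
  coboundary-density : ∀ {n} (E : System 2 n) → Minimal E → 3 ℕ.≤ n → ∀ {b η ρ} →
    0ℚ < b → b + η ≤ ‖ E ‖ → b + η ≤ η * ι (+ n) →
    0ℚ ≤ ρ → ρ ≤ 3/₂ → 9/₁ * b ≤ (3/₁ - ρ) * (3/₁ - 2/₁ * ρ) →
    ρ * b ≤ ‖ δ E ‖
  coboundary-density {n} E E-min 3≤n {b} {η} {ρ} 0<b b+η≤E b+η≤ηn 0≤ρ ρ≤3/2 9b≤ = cancel-* (ι (+ (n C 3))) (ι-pos (n C 3)) (begin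
    C₃ * (ρ * b)              ≤⟨ cancel-* (ι (+ 6)) 0<6 (begin
      ι (+ 6) * (C₃ * (ρ * b))     ≡⟨ solve 3 (λ s c r → s :* (c :* r) := r :* (s :* c)) refl (ι (+ 6)) C₃ (ρ * b) ⟩
      ρ * b * (ι (+ 6) * C₃)       ≤⟨ mono-* (ρ * b) (*-nonneg 0≤ρ (<⇒≤ 0<b)) 6C₃≤N³ ⟩
      ρ * b * (N * (N * N))        ≤⟨ triples-bound 0<N 0<b bN²≤e Ne≤T main 0≤ρ ρ≤3/2 9b≤ ⟩
      ι G.T                        ≤⟨ ι-mono (sum-odd≤6∣δE∣ E) ⟩
      ι (+ 6 ℤ.* + card (δ E))     ≡⟨ ι-* (+ 6) (+ card (δ E)) ⟩
      ι (+ 6) * ι (+ card (δ E))   ∎) ⟩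
    ι (+ card (δ E))          ≡⟨ ratio-* (card (δ E)) (n C 3) ⟨
    ‖ δ E ‖ * C₃              ≡⟨ *-comm ‖ δ E ‖ C₃ ⟩
    C₃ * ‖ δ E ‖              ∎)
    where
    open ≤-Reasoning
    module G = Graph (adj E) (adj-sym E)
    instance
      C₂≢0 : ℕ.NonZero (n C 2)
      C₂≢0 = nC2≢0 n (ℕₚ.≤-trans (ℕₚ.n≤1+n 2) 3≤n)
      C₃≢0 : ℕ.NonZero (n C 3)
      C₃≢0 = nC3≢0 n 3≤n
      n≢0 : ℕ.NonZero n
      n≢0 = ℕ.>-nonZero (ℕₚ.<-≤-trans (ℕ.s≤s ℕ.z≤n) 3≤n)
    N = ι (+ n)
    C₂ = ι (+ (n C 2))
    C₃ = ι (+ (n C 3))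
    e = ι G.e
    0<N : 0ℚ < N
    0<N = ι-pos n
    0<6 : 0ℚ < ι (+ 6)
    0<6 = toWitness {a? = 0ℚ <? ι (+ 6)} _

    -- Switching preserves the coboundary, so `E-min` compares densities over the same denominator.
    no-cut = λ s → cut-nonpos E s (ratio-cancel-≤ (n C 2) (E-min (switch E s) (δ-switch E s)))

    6C₃≤N³ : ι (+ 6) * C₃ ≤ N * (N * N)
    6C₃≤N³ = subst₂ _≤_ (trans (cong ι (ℤₚ.pos-* 6 (n C 3))) (ι-* (+ 6) (+ (n C 3))))
      (trans (cong ι (trans (ℤₚ.pos-* n (n ℕ.* n)) (cong (+ n ℤ.*_) (ℤₚ.pos-* n n))))
        (trans (ι-* (+ n) (+ n ℤ.* + n)) (cong (N *_) (ι-* (+ n) (+ n)))))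
      (ι-mono (ℤ.+≤+ (6*[nC3]≤n³ n)))

    2C₂+N≡N² : 2/₁ * C₂ + N ≡ N * N
    2C₂+N≡N² = trans (cong (λ k → k + N) (sym (trans (cong ι (ℤₚ.pos-* 2 (n C 2))) (ι-* (+ 2) (+ (n C 2))))))
      (trans (sym (ι-+ (+ (2 ℕ.* (n C 2))) (+ n))) (trans (cong (λ k → ι (+ k)) (2*[nC2]+n≡n*n n))
        (trans (cong ι (ℤₚ.pos-* n n)) (ι-* (+ n) (+ n)))))

    2∣E∣≡e : 2/₁ * ι (+ card E) ≡ e
    2∣E∣≡e = trans (sym (ι-* (+ 2) (+ card E))) (cong ι (sym (sum-adj E)))

    bN²≤e : b * (N * N) ≤ e
    bN²≤e = begin
      b * (N * N)                      ≡⟨ solve 3 (λ b h n → b :* (n :* n) := n :* ((b :+ h) :* n :- h :* n)) refl b η N ⟩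
      N * ((b + η) * N - η * N)        ≤⟨ mono-* N (<⇒≤ 0<N) (+-monoʳ-≤ ((b + η) * N) (neg-antimono-≤ b+η≤ηn)) ⟩
      N * ((b + η) * N - (b + η))      ≡⟨ solve 2 (λ b n → n :* (b :* n :- b) := b :* (n :* n :- n)) refl (b + η) N ⟩
      (b + η) * (N * N - N)            ≡⟨ cong (λ z → (b + η) * (z - N)) 2C₂+N≡N² ⟨
      (b + η) * (2/₁ * C₂ + N - N)     ≡⟨ solve 3 (λ b c n → b :* (con 2/₁ :* c :+ n :- n) := con 2/₁ :* (b :* c)) refl (b + η) C₂ N ⟩
      2/₁ * ((b + η) * C₂)             ≤⟨ mono-* 2/₁ (toWitness {a? = 0ℚ ≤? 2/₁} _) (*-monoʳ-≤-nonNeg C₂ {{nonNegative (<⇒≤ (ι-pos (n C 2)))}} b+η≤E) ⟩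
      2/₁ * (‖ E ‖ * C₂)               ≡⟨ cong (2/₁ *_) (ratio-* (card E) (n C 2)) ⟩
      2/₁ * ι (+ card E)               ≡⟨ 2∣E∣≡e ⟩
      e                                ∎

    Ne≤T : N * e ≤ ι G.T
    Ne≤T = subst (_≤ ι G.T) (ι-* (+ n) G.e) (ι-mono (G.Ne≤T no-cut))

    main : e * ((3/₁ * (N * e) - ι G.T) * (3/₁ * (N * e) - 2/₁ * ι G.T)) ≤ e * (9/₁ * (e * (e * e)))
    main = subst₂ _≤_
      (trans (ι-* e′ ((3Ne′ ℤ.- t′) ℤ.* (3Ne′ ℤ.- + 2 ℤ.* t′))) (cong (e *_) (trans (ι-* (3Ne′ ℤ.- t′) (3Ne′ ℤ.- + 2 ℤ.* t′)) (cong₂ _*_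
        (trans (ι-sub 3Ne′ t′) (cong (_- ι t′) 3Ne))
        (trans (ι-sub 3Ne′ (+ 2 ℤ.* t′)) (cong₂ _-_ 3Ne (ι-* (+ 2) t′)))))))
      (trans (ι-* e′ (+ 9 ℤ.* e³)) (cong (e *_) (trans (ι-* (+ 9) e³) (cong (9/₁ *_)
        (trans (ι-* e′ (e′ ℤ.* e′)) (cong (e *_) (ι-* e′ e′)))))))
      (ι-mono (G.[3Ne-T][3Ne-2T]≤9e³ no-cut))
      where
      e′ = G.e
      t′ = G.T
      e³ = e′ ℤ.* (e′ ℤ.* e′)
      3Ne′ = + 3 ℤ.* (+ n ℤ.* e′)
      3Ne : ι 3Ne′ ≡ 3/₁ * (N * e)
      3Ne = trans (ι-* (+ 3) (+ n ℤ.* e′)) (cong (3/₁ *_) (ι-* (+ n) e′))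

  -- Error estimates for approximations of the density and the root.

  8/₁ 16/₁ ¾ : ℚ
  8/₁ = + 8 / 1
  16/₁ = + 16 / 1
  ¾ = + 3 / 4

  -- The index at which α is evaluated is fixed; a and s are the approximations
  -- of α and √(8α + 1) there, and t bounds the error of s as a square root.
  module Perturbation {q η a s t : ℚ} (0≤q : 0ℚ ≤ q) (0<η : 0ℚ < η) (a≤1 : a ≤ 1ℚ)
    (0≤s : 0ℚ ≤ s) (0≤t : 0ℚ ≤ t) (t≤η : t ≤ η)
    (s-lower : (s ≡ 0ℚ) ⊎ (s * s ≤ 8/₁ * a + 1ℚ)) (s-upper : 8/₁ * a + 1ℚ < (s + t) * (s + t))
    (q< : q + 16/₁ * η ≤ ¾ * a * (3/₁ - s)) where

    open ≤-Reasoning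

    -- The 3η in `b` pay for moving the index of α, for the slack in α ≤ `‖ E ‖` and for the `η` of
    -- `coboundary-density`. The overestimate `s + t` of the root in `ρ` makes `9b≤` true, while
    -- `a * c` is the claimed bound at the chosen index.
    b ρ c : ℚ
    b = a - 3/₁ * η
    ρ = ¾ * (3/₁ - (s + t))
    c = ¾ * (3/₁ - s)

    0≤η : 0ℚ ≤ η
    0≤η = <⇒≤ 0<η

    private
      0≤¾ : 0ℚ ≤ ¾
      0≤¾ = toWitness {a? = 0ℚ ≤? ¾} _

      s≤3 : s ≤ 3/₁
      s≤3 = [ (λ s≡0 → subst (_≤ 3/₁) (sym s≡0) 0≤3) , (λ s²≤ → square-cancel-≤ 0≤3 (≤-trans s²≤ (≤-trans
          (+-monoˡ-≤ 1ℚ (mono-* 8/₁ (toWitness {a? = 0ℚ ≤? 8/₁} _) a≤1)) (toWitness {a? = 8/₁ * 1ℚ + 1ℚ ≤? 3/₁ * 3/₁} _)))) ]′ s-lower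
        where
        0≤3 = toWitness {a? = 0ℚ ≤? 3/₁} _

      0≤c : 0ℚ ≤ c
      0≤c = *-nonneg 0≤¾ (p≤q⇒0≤q-p s≤3)

      c≤9/4 : c ≤ + 9 / 4
      c≤9/4 = mono-* ¾ 0≤¾ (subst (3/₁ - s ≤_) (+-identityʳ 3/₁) (+-monoʳ-≤ 3/₁ (neg-antimono-≤ 0≤s)))

      q+16η≤ac : q + 16/₁ * η ≤ a * c
      q+16η≤ac = subst (q + 16/₁ * η ≤_) (solve 3 (λ k a x → k :* a :* x := a :* (k :* x)) refl ¾ a (3/₁ - s)) q<

      16η≤ac : 16/₁ * η ≤ a * c
      16η≤ac = ≤-trans (subst (_≤ q + 16/₁ * η) (+-identityˡ _) (+-monoˡ-≤ (16/₁ * η) 0≤q)) q+16η≤ac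

    -- Otherwise `a * c` would be at most 3η · 9/4 = 27η/4, but it is at least 16η.
    3η<a : 3/₁ * η < a
    3η<a with a ≤? 3/₁ * η
    ... | no a≰3η  = ≰⇒> a≰3η
    ... | yes a≤3η = contradiction (begin-strict
      16/₁ * η               ≤⟨ 16η≤ac ⟩
      a * c                  ≤⟨ *-monoʳ-≤-nonNeg c {{nonNegative 0≤c}} a≤3η ⟩
      3/₁ * η * c            ≤⟨ mono-* (3/₁ * η) (*-nonneg (toWitness {a? = 0ℚ ≤? 3/₁} _) 0≤η) c≤9/4 ⟩
      3/₁ * η * (+ 9 / 4)    ≡⟨ solve 1 (λ h → con 3/₁ :* h :* con (+ 9 / 4) := con (+ 27 / 4) :* h) refl η ⟩
      + 27 / 4 * η           <⟨ *-monoˡ-<-pos η {{positive 0<η}} (toWitness {a? = + 27 / 4 <? 16/₁} _) ⟩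
      16/₁ * η               ∎) (<-irrefl refl)

    0<b : 0ℚ < b
    0<b = subst (_< b) (+-inverseʳ (3/₁ * η)) (+-monoˡ-< (- (3/₁ * η)) 3η<a)

    private
      0<a : 0ℚ < a
      0<a = ≤-<-trans (*-nonneg (toWitness {a? = 0ℚ ≤? 3/₁} _) 0≤η) 3η<a

      ¾at≤¾η : ¾ * (a * t) ≤ ¾ * η
      ¾at≤¾η = mono-* ¾ 0≤¾ (≤-trans (*-monoʳ-≤-nonNeg t {{nonNegative 0≤t}} a≤1) (subst (_≤ η) (sym (*-identityˡ t)) t≤η))

    0≤ρ : 0ℚ ≤ ρ
    0≤ρ = cancel-* a 0<a (begin
      a * 0ℚ                  ≡⟨ *-zeroʳ a ⟩
      0ℚ                      ≤⟨ *-nonneg (toWitness {a? = 0ℚ ≤? 16/₁ - ¾} _) 0≤η ⟩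
      (16/₁ - ¾) * η          ≡⟨ solve 1 (λ h → con (16/₁ - ¾) :* h := con 16/₁ :* h :- con ¾ :* h) refl η ⟩
      16/₁ * η - ¾ * η        ≤⟨ +-mono-≤ 16η≤ac (neg-antimono-≤ ¾at≤¾η) ⟩
      a * c - ¾ * (a * t)     ≡⟨ solve 3 (λ a s t → a :* (con ¾ :* (con 3/₁ :- s)) :- con ¾ :* (a :* t) := a :* (con ¾ :* (con 3/₁ :- (s :+ t)))) refl a s t ⟩
      a * ρ                   ∎)

    ρ≤3/2 : ρ ≤ 3/₂
    ρ≤3/2 = mono-* ¾ 0≤¾ (+-monoʳ-≤ 3/₁ (neg-antimono-≤ 1≤s+t))
      where
      1≤s+t : 1ℚ ≤ s + t
      1≤s+t = square-cancel-≤ (+-mono-≤ 0≤s 0≤t) (begin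
        1ℚ * 1ℚ             ≡⟨⟩
        0ℚ + 1ℚ             ≤⟨ +-monoˡ-≤ 1ℚ (*-nonneg (toWitness {a? = 0ℚ ≤? 8/₁} _) (<⇒≤ 0<a)) ⟩
        8/₁ * a + 1ℚ        ≤⟨ <⇒≤ s-upper ⟩
        (s + t) * (s + t)   ∎)

    -- With w = s + t the factors on the right are ¾(w + 1) and 3/2 (w - 1), so their product is 9/8
    -- (w² - 1), which exceeds 9a because w² > 8a + 1.
    9b≤ : 9/₁ * b ≤ (3/₁ - ρ) * (3/₁ - 2/₁ * ρ)
    9b≤ = begin
      9/₁ * b                                       ≤⟨ mono-* 9/₁ (toWitness {a? = 0ℚ ≤? 9/₁} _) b≤a ⟩
      9/₁ * a                                       ≡⟨ solve 1 (λ a → con 9/₁ :* a := con (+ 9 / 8) :* (con 8/₁ :* a :+ con 1ℚ :- con 1ℚ)) refl a ⟩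
      + 9 / 8 * (8/₁ * a + 1ℚ - 1ℚ)                 ≤⟨ mono-* (+ 9 / 8) (toWitness {a? = 0ℚ ≤? + 9 / 8} _) (+-monoˡ-≤ (- 1ℚ) (<⇒≤ s-upper)) ⟩
      + 9 / 8 * ((s + t) * (s + t) - 1ℚ)            ≡⟨ solve 1 (λ w → con (+ 9 / 8) :* (w :* w :- con 1ℚ) :=
                                                       (con 3/₁ :- con ¾ :* (con 3/₁ :- w)) :* (con 3/₁ :- con 2/₁ :* (con ¾ :* (con 3/₁ :- w)))) refl (s + t) ⟩
      (3/₁ - ρ) * (3/₁ - 2/₁ * ρ)                   ∎
      where
      b≤a : b ≤ a
      b≤a = subst (b ≤_) (+-identityʳ a) (+-monoʳ-≤ a (neg-antimono-≤ (*-nonneg (toWitness {a? = 0ℚ ≤? 3/₁} _) 0≤η)))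

    -- Of the 16η, replacing `c` by `ρ` costs at most ¾η and replacing `a` by `b` at most 3η · 3/2,
    -- which leaves 8η + 11η/4.
    q+8η≤ρb : q + 8/₁ * η ≤ ρ * b
    q+8η≤ρb = begin
      q + 8/₁ * η                                   ≤⟨ p≤p+q (q + 8/₁ * η) (*-nonneg (toWitness {a? = 0ℚ ≤? + 11 / 4} _) 0≤η) ⟩
      q + 8/₁ * η + + 11 / 4 * η                    ≡⟨ solve 2 (λ q h → q :+ con 8/₁ :* h :+ con (+ 11 / 4) :* h :=
                                                       q :+ con 16/₁ :* h :- con ¾ :* h :- con 3/₁ :* (h :* con 3/₂)) refl q η ⟩
      q + 16/₁ * η - ¾ * η - 3/₁ * (η * 3/₂)        ≤⟨ +-mono-≤ (+-mono-≤ q+16η≤ac (neg-antimono-≤ ¾at≤¾η))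
                                                       (neg-antimono-≤ (mono-* 3/₁ (toWitness {a? = 0ℚ ≤? 3/₁} _) (mono-* η 0≤η ρ≤3/2))) ⟩
      a * c - ¾ * (a * t) - 3/₁ * (η * ρ)           ≡⟨ solve 4 (λ a s t h → a :* (con ¾ :* (con 3/₁ :- s)) :- con ¾ :* (a :* t) :- con 3/₁ :* (h :* (con ¾ :* (con 3/₁ :- (s :+ t))))
                                                       := con ¾ :* (con 3/₁ :- (s :+ t)) :* (a :- con 3/₁ :* h)) refl a s t η ⟩
      ρ * b                                         ∎

  -- The limit inferior.

  1≤ηn : ∀ {η n} → 0ℚ < η → suc (↧ₙ η) ℕ.≤ n → 1ℚ ≤ η * ι (+ n)
  1≤ηn {η} {suc m} 0<η (ℕ.s≤s ↧η≤m) = subst (_≤ η * ι (+ suc m)) (ratio-* 1 (suc m))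
    (*-monoʳ-≤-nonNeg (ι (+ suc m)) {{nonNegative (<⇒≤ (ι-pos (suc m)))}} (step≤ 0<η ↧η≤m))

  -- Densities are nonnegative, the default value for few vertices included, so q/2 is a strict
  -- lower bound from the start.
  φ-negative : ∀ d α q → q < 0ℚ → φ d α q
  φ-negative d α q q<0 = half q , q<half , 0 , λ n _ E _ → <-≤-trans half<0 (ratio-nonneg _ (n C suc d))
    where
    half<0 : half q < 0ℚ
    half<0 = subst (half q <_) (*-zeroʳ ½) (*-monoʳ-<-pos ½ q<0)
    q<half : q < half q
    q<half = subst₂ _<_ (half+half q) (+-identityʳ (half q)) (+-monoʳ-< (half q) half<0)

  φ-nonnegative : ∀ α q → α ≤ᴿ fromℚ (+ 2 / 9) → 0ℚ ≤ q →
    fromℚ q <ᴿ fromℚ ¾ *ᴿ α *ᴿ (fromℚ 3/₁ -ᴿ √ (fromℚ 8/₁ *ᴿ α +ᴿ fromℚ 1ℚ)) → φ 2 α q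
  φ-nonnegative α q α≤2/9 0≤q (ε , 0<ε , M , hM) = choose (split 16/₁ ε (toWitness {a? = 0ℚ <? 16/₁} _) 0<ε)
    where
    choose : ∃[ η ] 0ℚ < η × 16/₁ * η ≡ ε → φ 2 α q
    -- The slack ½ is chosen so that 2/9 + ½ ≤ 1, which yields `a≤1`.
    choose (η , 0<η , 16η≡ε) = settle (cauchy α η 0<η) (α≤2/9 ½ (toWitness {a? = 0ℚ <? ½} _))
      where
      settle : SettlesWithin (seq α) η → ∃[ L ] (∀ n → L ℕ.≤ n → seq α n ≤ + 2 / 9 + ½) → φ 2 α q
      -- Both inequalities around the witness are strict, so it lies between q and the bound q + 8η.
      -- From 3 vertices on the binomials are positive, and the other threshold gives b + η ≤ 1 ≤
      -- ηn.
      settle (K , hK) (L , hL) = q + 4/₁ * η , q<r , 3 ℕ.⊔ suc (↧ₙ η) , λ n N≤n E → λ (E-min , α≤E) → <-≤-trans r<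
          (≤-trans P.q+8η≤ρb (coboundary-density E E-min (ℕₚ.m⊔n≤o⇒m≤o 3 (suc (↧ₙ η)) N≤n) {η = η} P.0<b (b+η≤E E α≤E)
            (≤-trans b+η≤1 (1≤ηn 0<η (ℕₚ.m⊔n≤o⇒n≤o 3 (suc (↧ₙ η)) N≤n))) P.0≤ρ P.ρ≤3/2 P.9b≤))
        where
        4/₁ = + 4 / 1
        -- One index for all approximations: the gap to q, the Cauchy bound, `a≤1` and the error
        -- `step k` of the root hold there.
        k = (M ℕ.⊔ K) ℕ.⊔ (L ℕ.⊔ ↧ₙ η)
        a = seq α k
        s = √ℚ (8/₁ * a + 1ℚ) k
        M≤k : M ℕ.≤ k
        M≤k = ℕₚ.≤-trans (ℕₚ.m≤m⊔n M K) (ℕₚ.m≤m⊔n (M ℕ.⊔ K) _)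
        K≤k : K ℕ.≤ k
        K≤k = ℕₚ.≤-trans (ℕₚ.m≤n⊔m M K) (ℕₚ.m≤m⊔n (M ℕ.⊔ K) _)
        L≤k : L ℕ.≤ k
        L≤k = ℕₚ.≤-trans (ℕₚ.m≤m⊔n L (↧ₙ η)) (ℕₚ.m≤n⊔m (M ℕ.⊔ K) _)
        ↧η≤k : ↧ₙ η ℕ.≤ k
        ↧η≤k = ℕₚ.≤-trans (ℕₚ.m≤n⊔m L (↧ₙ η)) (ℕₚ.m≤n⊔m (M ℕ.⊔ K) _)
        a≤1 : a ≤ 1ℚ
        a≤1 = ≤-trans (hL k L≤k) (toWitness {a? = + 2 / 9 + ½ ≤? 1ℚ} _)
        module P = Perturbation {q} {η} {a} {s} {step k} 0≤q 0<η a≤1 (√ℚ-nonneg (8/₁ * a + 1ℚ) k) (nonneg-/ 1 k) (step≤ 0<η ↧η≤k)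
          (√ℚ-lower (8/₁ * a + 1ℚ) k) (√ℚ-upper (8/₁ * a + 1ℚ) k)
          (subst (λ z → q + z ≤ ¾ * a * (3/₁ - s)) (sym 16η≡ε) (hM k M≤k))
        b+η≡ : P.b + η ≡ a - (η + η)
        b+η≡ = solve 2 (λ a h → a :- con 3/₁ :* h :+ h := a :- (h :+ h)) refl a η
        b+η≤1 : P.b + η ≤ 1ℚ
        b+η≤1 = ≤-trans (subst₂ _≤_ (sym b+η≡) (+-identityʳ a) (+-monoʳ-≤ a (neg-antimono-≤ (+-mono-≤ P.0≤η P.0≤η)))) a≤1
        b+η≤E : ∀ {n} (E : System 2 n) → α ≤ᴿ fromℚ ‖ E ‖ → P.b + η ≤ ‖ E ‖
        b+η≤E E α≤E = near (α≤E η 0<η)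
          where
          open ≤-Reasoning
          near : ∃[ N ] (∀ m → N ℕ.≤ m → seq α m ≤ ‖ E ‖ + η) → P.b + η ≤ ‖ E ‖
          near (N , hN) = begin
            P.b + η                      ≡⟨ b+η≡ ⟩
            a - (η + η)                  ≤⟨ +-monoˡ-≤ (- (η + η)) (∣p-q∣≤r⇒p≤q+r a (seq α m) (hK k m K≤k (ℕₚ.≤-trans K≤k (ℕₚ.m≤n⊔m N k)))) ⟩
            seq α m + η - (η + η)        ≤⟨ +-monoˡ-≤ (- (η + η)) (+-monoˡ-≤ η (hN m (ℕₚ.m≤m⊔n N k))) ⟩
            ‖ E ‖ + η + η - (η + η)      ≡⟨ solve 2 (λ x h → x :+ h :+ h :- (h :+ h) := x) refl ‖ E ‖ η ⟩
            ‖ E ‖                        ∎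
            where m = N ℕ.⊔ k
        q<r : q < q + 4/₁ * η
        q<r = subst (_< q + 4/₁ * η) (+-identityʳ q) (+-monoʳ-< q (*-pos (toWitness {a? = 0ℚ <? 4/₁} _) 0<η))
        r< : q + 4/₁ * η < q + 8/₁ * η
        r< = +-monoʳ-< q (*-monoˡ-<-pos η {{positive 0<η}} (toWitness {a? = 4/₁ <? 8/₁} _))

theorem4 : (α : ℝ) → fromℚ 0ℚ ≤ᴿ α → α ≤ᴿ fromℚ (+ 2 / 9) →
    φ 2 α ≥ᴸ fromℚ (+ 3 / 4) *ᴿ α *ᴿ (fromℚ (+ 3 / 1) -ᴿ √ (fromℚ (+ 8 / 1) *ᴿ α +ᴿ fromℚ (+ 1 / 1)))
theorem4 α _ α≤2/9 q q<bound = decide (0ℚ ≤? q)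
  where
  open import Data.Rational using (_≤_; _≤?_)
  open import Data.Rational.Properties using (≰⇒>)
  open Densities
  -- For 0 ≤ q the gap below the bound keeps `a` away from 0, as `Perturbation` requires.
  decide : Dec (0ℚ ≤ q) → φ 2 α q
  decide (yes 0≤q) = φ-nonnegative α q α≤2/9 0≤q q<bound
  decide (no  0≰q) = φ-negative 2 α q (≰⇒> 0≰q)
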